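{- Let $D$ be an infinite division ring, $I$ a set, and $\mathcal{F}$ a filter on $I$ which is not the intersection of finitely many $\mathrm{card}(D)^+$-complete ultrafilters. Then $$\dim_D\,(D^I/\mathcal{F})\ =\ \mathrm{card}(D^I/\mathcal{F}),$$ where $\dim_D$ can be taken to mean the dimension either as a right or as a left $D$-vector space.
   Context: A filter on $I$ is a set of subsets of $I$ containing $I$, closed under passing to larger subsets of $I$, and closed under pairwise intersections; it may be improper (equal to the set of all subsets of $I$). An ultrafilter is a maximal proper filter. A filter is $\kappa$-complete ($\kappa$ an infinite cardinal) if it is closed under intersections of families of $<\kappa$ members. Convention: the intersection of the empty family of ultrafilters is the improper filter, and "finitely many" allows zero. $\mathrm{card}(D)^+$ is the successor cardinal of $\mathrm{card}(D)$. $D^I/\mathcal{F}$ is the reduced power: the quotient of $D^I$ by the relation $(a_i)\sim(b_i)$ iff $\{i\mid a_i=b_i\}\in\mathcal{F}$, with its induced $D$-vector space structures. -}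

module Defs where

open import Algebra.Bundles using (Ring; RawMonoid)
open import Algebra.Definitions using (Invertible)
open import Algebra.Definitions.RawMonoid using (sum)
open import Algebra.Module.Bundles using (LeftModule; RightModule; Bimodule)
open import Axiom.ExcludedMiddle using (ExcludedMiddle)
open import Data.Fin.Base using (Fin)
open import Data.Nat.Base using (ℕ)
open import Data.Product.Base using (Σ; Σ-syntax; ∃-syntax; _×_; _,_)
open import Function.Base using (flip)
open import Function.Bundles using (Func; Injection; Surjection; Bijection; _⇔_)
open import Function.Definitions using (Injective)
open import Level using (Level; suc; _⊔_; Setω)
open import Relation.Binary.Bundles using (Setoid)
open import Relation.Binary.PropositionalEquality.Core using (_≡_)
import Relation.Binary.PropositionalEquality.Properties as ≡
open import Relation.Nullary.Negation.Core using (¬_)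
open import Relation.Unary using (Pred; _∈_; _⊆_; _∩_; ⋂)
open import Relation.Unary.Polymorphic using (U)

private
  variable
    a b c d ℓ ℓ₁ ℓ₂ : Level

-- The classical metatheory.  Sets are setoids, so choice asks for a section
-- that respects the setoid equalities; a section that does not do so is
-- already contained in the constructive meaning of surjectivity.

record Classical : Setω where
  field
    excludedMiddle : ∀ {ℓ} → ExcludedMiddle ℓ
    choice : ∀ {a b ℓ₁ ℓ₂} {A : Setoid a ℓ₁} {B : Setoid b ℓ₂}
             (f : Surjection A B) →
             Σ[ g ∈ Func B A ]
               (∀ y → Setoid._≈_ B (Surjection.to f (Func.to g y)) y)

-- Cardinals are represented by setoids, compared by injections; equality of
-- cardinals is the existence of a Bijection.

_≺_ : Setoid a ℓ₁ → Setoid b ℓ₂ → Set (a ⊔ b ⊔ ℓ₁ ⊔ ℓ₂)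
A ≺ B = Injection A B × ¬ Injection B A

record IsSuccessorCardinal (κ⁺ κ : Setoid ℓ ℓ) : Set (suc ℓ) where
  field
    larger : κ ≺ κ⁺
    least  : (X : Setoid ℓ ℓ) → κ ≺ X → Injection κ⁺ X

Infinite : Setoid a ℓ → Set (a ⊔ ℓ)
Infinite A = ¬ (∃[ n ] Bijection (≡.setoid (Fin n)) A)

record DivisionRing c ℓ : Set (suc (c ⊔ ℓ)) where
  field
    ring : Ring c ℓ

  open Ring ring public

  field
    1≉0        : 1# ≉ 0#
    invertible : ∀ x → x ≉ 0# → Invertible _≈_ 1# _*_ x

record Filter (I : Set ℓ) : Set (suc ℓ) where
  field
    Member   : Pred (Pred I ℓ) ℓ
    whole    : U ∈ Member
    upward   : ∀ {A B} → A ⊆ B → A ∈ Member → B ∈ Member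
    ∩-closed : ∀ {A B} → A ∈ Member → B ∈ Member → A ∩ B ∈ Member

open Filter using (Member)

module _ {I : Set ℓ} where

  Proper : Filter I → Set (suc ℓ)
  Proper F = ¬ (∀ A → A ∈ Member F)

  record IsUltrafilter (F : Filter I) : Set (suc ℓ) where
    field
      proper  : Proper F
      maximal : (G : Filter I) → Proper G →
                Member F ⊆ Member G → Member G ⊆ Member F

  Complete : Setoid ℓ ℓ → Filter I → Set (suc ℓ)
  Complete κ F = (X : Set ℓ) → ≡.setoid X ≺ κ →
                 (A : X → Pred I ℓ) → (∀ x → A x ∈ Member F) →
                 ⋂ X A ∈ Member F

  IsFiniteIntersectionOfCompleteUltrafilters : Setoid ℓ ℓ → Filter I → Set (suc ℓ)
  IsFiniteIntersectionOfCompleteUltrafilters κ F =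
    Σ[ n ∈ ℕ ] Σ[ V ∈ (Fin n → Filter I) ]
      (∀ j → IsUltrafilter (V j) × Complete κ (V j)) ×
      (∀ A → A ∈ Member F ⇔ (∀ j → A ∈ Member (V j)))

-- Bases for a scalar action of K on M, written uniformly so that left and
-- right modules share the definition.

module Basis (K : Ring c d) (M : RawMonoid a ℓ)
             (_·_ : Ring.Carrier K → RawMonoid.Carrier M → RawMonoid.Carrier M)
             where

  private
    module K = Ring K
    module M = RawMonoid M

  record IsBasis (B : Setoid b ℓ₁) (e : Setoid.Carrier B → M.Carrier)
                 : Set (a ⊔ b ⊔ c ⊔ d ⊔ ℓ ⊔ ℓ₁) where
    private module B = Setoid B
    field
      congruent : ∀ {x y} → x B.≈ y → e x M.≈ e y
      linearlyIndependent :
        ∀ {n} (x : Fin n → B.Carrier) → Injective _≡_ B._≈_ x →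
        (k : Fin n → K.Carrier) → sum M (λ j → k j · e (x j)) M.≈ M.ε →
        ∀ j → k j K.≈ K.0#
      spanning :
        ∀ v → Σ[ n ∈ ℕ ] Σ[ x ∈ (Fin n → B.Carrier) ] Σ[ k ∈ (Fin n → K.Carrier) ]
          v M.≈ sum M (λ j → k j · e (x j))

  -- The dimension is the cardinality of a basis.
  HasDimension : Setoid ℓ₁ ℓ₂ → Set (a ⊔ c ⊔ d ⊔ ℓ ⊔ suc (ℓ₁ ⊔ ℓ₂))
  HasDimension {ℓ₁} {ℓ₂} κ =
    Σ[ B ∈ Setoid ℓ₁ ℓ₂ ] Σ[ e ∈ (Setoid.Carrier B → M.Carrier) ]
      IsBasis B e × Bijection B κ

module _ {K : Ring c d} where

  HasLeftDimension : LeftModule K a ℓ → Setoid ℓ₁ ℓ₂ →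
                     Set (a ⊔ c ⊔ d ⊔ ℓ ⊔ suc (ℓ₁ ⊔ ℓ₂))
  HasLeftDimension M = Basis.HasDimension K +ᴹ-rawMonoid _*ₗ_
    where open LeftModule M

  HasRightDimension : RightModule K a ℓ → Setoid ℓ₁ ℓ₂ →
                      Set (a ⊔ c ⊔ d ⊔ ℓ ⊔ suc (ℓ₁ ⊔ ℓ₂))
  HasRightDimension M = Basis.HasDimension K +ᴹ-rawMonoid (flip _*ᵣ_)
    where open RightModule M

-- The reduced power: I → D with equality "equal on a member of the filter"
-- and pointwise operations.

module _ (D : DivisionRing ℓ ℓ) {I : Set ℓ} (F : Filter I) where

  private
    module D = DivisionRing D
    module F = Filter F

    everywhere : {A : Pred I ℓ} → (∀ i → A i) → A ∈ F.Member
    everywhere p = F.upward (λ {i} _ → p i) F.whole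

  reducedPower : Bimodule D.ring D.ring ℓ ℓ
  reducedPower = record
    { Carrierᴹ = I → D.Carrier
    ; _≈ᴹ_ = λ x y → (λ i → x i D.≈ y i) ∈ F.Member
    ; _+ᴹ_ = λ x y i → x i D.+ y i
    ; _*ₗ_ = λ k x i → k D.* x i
    ; _*ᵣ_ = λ x k i → x i D.* k
    ; 0ᴹ = λ _ → D.0#
    ; -ᴹ_ = λ x i → D.- x i
    ; isBimodule = record
      { isBisemimodule = record
        { +ᴹ-isCommutativeMonoid = record
          { isMonoid = record
            { isSemigroup = record
              { isMagma = record
                { isEquivalence = record
                  { refl = everywhere (λ _ → D.refl)
                  ; sym = F.upward D.sym
                  ; trans = λ p q →
                      F.upward (λ (r , s) → D.trans r s) (F.∩-closed p q)
                  }
                ; ∙-cong = λ p q →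
                    F.upward (λ (r , s) → D.+-cong r s) (F.∩-closed p q)
                }
              ; assoc = λ x y z → everywhere (λ i → D.+-assoc (x i) (y i) (z i))
              }
            ; identity = (λ x → everywhere (λ i → D.+-identityˡ (x i)))
                       , (λ x → everywhere (λ i → D.+-identityʳ (x i)))
            }
          ; comm = λ x y → everywhere (λ i → D.+-comm (x i) (y i))
          }
        ; isPreleftSemimodule = record
          { *ₗ-cong = λ p → F.upward (D.*-cong p)
          ; *ₗ-zeroˡ = λ x → everywhere (λ i → D.zeroˡ (x i))
          ; *ₗ-distribʳ = λ x k l → everywhere (λ i → D.distribʳ (x i) k l)
          ; *ₗ-identityˡ = λ x → everywhere (λ i → D.*-identityˡ (x i))
          ; *ₗ-assoc = λ k l x → everywhere (λ i → D.*-assoc k l (x i))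
          ; *ₗ-zeroʳ = λ k → everywhere (λ _ → D.zeroʳ k)
          ; *ₗ-distribˡ = λ k x y → everywhere (λ i → D.distribˡ k (x i) (y i))
          }
        ; isPrerightSemimodule = record
          { *ᵣ-cong = λ p q → F.upward (λ r → D.*-cong r q) p
          ; *ᵣ-zeroʳ = λ x → everywhere (λ i → D.zeroʳ (x i))
          ; *ᵣ-distribˡ = λ x k l → everywhere (λ i → D.distribˡ (x i) k l)
          ; *ᵣ-identityʳ = λ x → everywhere (λ i → D.*-identityʳ (x i))
          ; *ᵣ-assoc = λ x k l → everywhere (λ i → D.*-assoc (x i) k l)
          ; *ᵣ-zeroˡ = λ k → everywhere (λ _ → D.zeroˡ k)
          ; *ᵣ-distribʳ = λ k x y → everywhere (λ i → D.distribʳ k (x i) (y i))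
          }
        ; *ₗ-*ᵣ-assoc = λ k x l → everywhere (λ i → D.*-assoc k (x i) l)
        }
      ; -ᴹ‿cong = F.upward D.-‿cong
      ; -ᴹ‿inverse = (λ x → everywhere (λ i → D.-‿inverseˡ (x i)))
                   , (λ x → everywhere (λ i → D.-‿inverseʳ (x i)))
      }
    }

{-# OPTIONS --safe #-}

-- The reduced power V = D^I/F has at most as many elements as there are finite
-- sequences over D × B, for any basis B; so it suffices to find linearly
-- independent vectors indexed by a set at least as large as D.
--
-- Let X be a well-ordered set at least as large as D whose initial segments are
-- smaller than D.  By the hypothesis on F there are a map h from I to X and a
-- part T of I such that, for every S in F, the set h(S ∩ T) is nonempty without
-- a maximum: either I splits into infinitely many F-positive pieces, or F is a
-- finite intersection of ultrafilters one of which is incomplete, and h is made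
-- from a family witnessing the incompleteness.
--
-- Choose g(a, x) in D, for a and x in X, by recursion on the lexicographic order.
-- Call g(a, x) forced if there are finitely many a_j < a and x_k < x, and
-- scalars d_k with g(a_j, x) = Σ_k g(a_j, x_k) d_k for all j, such that
-- g(a, x) = Σ_k g(a, x_k) d_k for each such choice of scalars.  Finite
-- sequences over the segments below a and x are fewer than the elements of D, so
-- g(a, x) can be chosen not to be forced.  If on some S in F the function
-- i ↦ g(a, h i) were a combination Σ_j c_j g(a_j, h i), take finitely many x_k in
-- h(S ∩ T) whose columns (g(a_j, x_k))_j span all the columns over h(S ∩ T), and a
-- larger x in h(S ∩ T): applying the c_j to the relation between the columns
-- shows that g(a, x) is forced.

module Submission where

open import Defs
open import Algebra.Module.Bundles using (Bimodule; LeftModule)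
import Algebra.Construct.Flip.Op as Op
open import Algebra.Definitions.RawMonoid using () renaming (sum to rawSum)
import Algebra.Properties.CommutativeMonoid.Sum as Sum
import Algebra.Properties.Group as GroupProperties
import Algebra.Properties.Semiring.Sum as SemiringSum
open import Axiom.ExcludedMiddle using (ExcludedMiddle)
open import Data.Bool.Base as Bool using (Bool)
open import Data.Bool.Properties using (T-irrelevant)
open import Data.Empty using (⊥; ⊥-elim)
open import Data.Fin.Base using (Fin; zero; suc; combine; fromℕ<; punchIn; punchOut; splitAt; _↑ˡ_; _↑ʳ_)
import Data.Fin.Properties as Fin
open import Data.Maybe.Base as Maybe using (Maybe; just; nothing)
import Data.Maybe.Properties as Maybe
open import Data.Nat.Base as ℕ using (ℕ; z≤n; s≤s)
import Data.Nat.Induction as ℕ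
import Data.Nat.Properties as ℕ
open import Data.Product.Base using (Σ; Σ-syntax; ∃-syntax; _×_; _,_; proj₁; proj₂)
open import Data.Product.Function.NonDependent.Propositional using (_×-↣_)
open import Data.Product.Relation.Binary.Lex.Strict using (×-Lex; ×-compare; ×-wellFounded)
open import Data.Sum.Base using (_⊎_; inj₁; inj₂; [_,_]′)
open import Data.Sum.Relation.Binary.LeftOrder
  using (_⊎-<_; ₁∼₁; ₁∼₂; ₂∼₂; ⊎-<-transitive; ⊎-<-trichotomous; ⊎-<-wellFounded)
import Data.Sum.Relation.Binary.Pointwise as Pointwise
open import Data.Vec.Base as Vec using (Vec; []; _∷_)
import Data.Vec.Functional as Vector
open import Data.Vec.Functional.Properties using (lookup-++ˡ; lookup-++ʳ)
import Data.Vec.Properties as Vec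
open import Function.Base using (_∘_; _on_; case_of_; id)
open import Function.Bundles using (Bijection; Func; Injection; mk↣; mk⇔; _↣_)
open import Function.Construct.Composition using (_↣-∘_)
open import Function.Construct.Identity using (↣-id)
open import Function.Definitions using (Injective)
open import Induction.WellFounded using (Acc; acc; WellFounded; module All; module FixPoint)
open import Level using (Level; Lift; lift; lower; _⊔_)
open import Relation.Binary.Bundles using (Setoid)
import Relation.Binary.Construct.On as On
open import Relation.Binary.Core using (Rel)
open import Relation.Binary.Definitions using (Irrelevant; Transitive; Trichotomous; tri<; tri≈; tri>)
open import Relation.Binary.PropositionalEquality as ≡ using (_≡_; _≢_)
import Relation.Binary.Reasoning.Setoid as SetoidReasoning
open import Relation.Nullary.Decidable
  using (Dec; decidable-stable; fromWitness; isYes; no; toWitness; True; yes)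
open import Relation.Nullary.Negation using (¬_; contradiction)
open import Relation.Unary using (Pred; _∈_; _⊆_; _∩_; ∁; ⋂)
open import Relation.Unary.Polymorphic using (U)

private
  variable
    a b ℓ ℓ₁ ℓ₂ r : Level
    A B : Set a

-- Well-orders

-- `irrelevant` makes a segment a genuine subset: its elements are equal as soon as their first
-- components are, as the embeddings between segments require.
record WellOrder (A : Set a) : Set (Level.suc a) where
  infix 4 _<_
  field
    _<_         : Rel A a
    <-trans     : Transitive _<_
    compare     : Trichotomous _≡_ _<_
    wellFounded : WellFounded _<_
    irrelevant  : Irrelevant _<_

  irrefl : ∀ {x} → ¬ (x < x)
  irrefl {x} x<x with compare x x
  ... | tri< _ x≢x _ = x≢x ≡.refl
  ... | tri≈ x≮x _ _ = x≮x x<x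
  ... | tri> _ x≢x _ = x≢x ≡.refl

  Seg : A → Set a
  Seg x = Σ[ y ∈ A ] y < x

  seg-injective : ∀ {x} {p q : Seg x} → proj₁ p ≡ proj₁ q → p ≡ q
  seg-injective {p = y , p} {q = _ , q} ≡.refl = ≡.cong (y ,_) (irrelevant p q)

-- Choice, well-founded recursion and Zermelo's theorem

module Choice (C : Classical) where

  open Classical C

  em : ∀ {ℓ} → ExcludedMiddle ℓ
  em = excludedMiddle

  dne : {P : Set ℓ} → ¬ ¬ P → P
  dne = decidable-stable em

  -- The surjection to be split is the projection from the graph of `R`, whose equality compares
  -- arguments up to `B` and values up to identity. The section may land over another representative
  -- of the argument, and `resp` carries the relation back.
  choose : (B : Setoid b ℓ₁) {A : Set a} (let module B = Setoid B)
           (R : B.Carrier → A → Set r) →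
           (∀ {x y z} → x B.≈ y → R x z → R y z) →
           (∀ x → Σ A (R x)) →
           Σ[ f ∈ (B.Carrier → A) ] (∀ {x y} → x B.≈ y → f x ≡ f y) × (∀ x → R x (f x))
  choose B {A} R resp total = (λ x → proj₁ (proj₂ (to x))) , (λ x≈y → proj₂ (Func.cong g x≈y))
                            , λ x → resp (section x) (proj₂ (proj₂ (to x)))
    where
    module B = Setoid B
    G : Setoid _ _
    G = record
      { Carrier = Σ[ x ∈ B.Carrier ] Σ A (R x)
      ; _≈_ = λ (x , y , _) (x′ , y′ , _) → x B.≈ x′ × y ≡ y′
      ; isEquivalence = record
        { refl  = B.refl , ≡.refl
        ; sym   = λ (p , q) → B.sym p , ≡.sym q
        ; trans = λ (p , q) (p′ , q′) → B.trans p p′ , ≡.trans q q′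
        }
      }
    chosen = choice {A = G} {B = B} (record
      { to = proj₁ ; cong = proj₁ ; surjective = λ x → (x , total x) , proj₁ })
    g = proj₁ chosen
    to = Func.to g
    section = proj₂ chosen

  representative : (B : Setoid b ℓ₁) (let module B = Setoid B) →
                   Σ[ f ∈ (B.Carrier → B.Carrier) ]
                     (∀ {x y} → x B.≈ y → f x ≡ f y) × (∀ x → f x B.≈ x)
  representative B = choose B (λ x y → y ≈ x) (λ x≈y z≈x → B.trans z≈x x≈y) (λ x → x , B.refl)
    where
    module B = Setoid B
    open B using (_≈_)

  minimal : {A : Set a} {_<_ : Rel A r} → WellFounded _<_ → (P : A → Set ℓ) →
            Σ A P → Σ[ x ∈ A ] P x × (∀ {y} → y < x → ¬ P y)
  minimal {A = A} {_<_} wf P (x , px) = go (wf x) px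
    where
    go : ∀ {x} → Acc _<_ x → P x → Σ[ x ∈ A ] P x × (∀ {y} → y < x → ¬ P y)
    go {x} (acc rs) px with em {P = Σ[ y ∈ A ] y < x × P y}
    ... | yes (y , y<x , py) = go (rs y<x) py
    ... | no none = x , px , λ y<x py → none (_ , y<x , py)

  -- A step only depends on the earlier values, so the choice of the next value
  -- is made on the setoid of functions that agree below w; this replaces
  -- function extensionality.
  recursion : {W : Set a} {_<_ : Rel W r} → WellFounded _<_ →
              {X : Set b} → X → (R : W → (W → X) → X → Set ℓ) →
              (∀ {w h h′ x} → (∀ {v} → v < w → h v ≡ h′ v) → R w h x → R w h′ x) →
              (∀ w h → Σ X (R w h)) →
              Σ[ g ∈ (W → X) ] (∀ w → R w g (g w))
  recursion {W = W} {_<_} wf {X} x₀ R local total =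
    g , λ w → ≡.subst (R w g) (≡.sym (g-unfold w)) (proj₂ (proj₂ (next w)) g)
    where
    Below : W → Setoid _ _
    Below w = record
      { Carrier = W → X
      ; _≈_ = λ h h′ → ∀ {v} → v < w → h v ≡ h′ v
      ; isEquivalence = record
        { refl = λ _ → ≡.refl
        ; sym = λ p v<w → ≡.sym (p v<w)
        ; trans = λ p q v<w → ≡.trans (p v<w) (q v<w)
        }
      }
    next : ∀ w → Σ[ f ∈ ((W → X) → X) ]
             (∀ {h h′} → Setoid._≈_ (Below w) h h′ → f h ≡ f h′) × (∀ h → R w h (f h))
    next w = choose (Below w) (R w) local (total w)

    extend : ∀ w → (∀ {v} → v < w → X) → ∀ v → Dec (v < w) → X
    extend w h v (yes v<w) = h v<w
    -- The equality of `Below w` ignores values outside the segment, so any default will do.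
    extend w h v (no  _)   = x₀

    step : ∀ w → (∀ {v} → v < w → X) → X
    step w h = proj₁ (next w) (λ v → extend w h v em)

    extend-cong : ∀ w {h h′ : ∀ {v} → v < w → X} →
                  (∀ {v} (p : v < w) → h p ≡ h′ p) → ∀ v d → extend w h v d ≡ extend w h′ v d
    extend-cong w eq v (yes p) = eq p
    extend-cong w eq v (no  _) = ≡.refl

    step-ext : ∀ w {h h′ : ∀ {v} → v < w → X} →
               (∀ {v} (p : v < w) → h p ≡ h′ p) → step w h ≡ step w h′
    step-ext w eq = proj₁ (proj₂ (next w)) (λ {v} _ → extend-cong w eq v em)

    g : W → X
    g = All.wfRec wf _ (λ _ → X) step

    extend-g : ∀ w {v} → v < w → ∀ d → extend w (λ {u} _ → g u) v d ≡ g v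
    extend-g w p (yes _) = ≡.refl
    extend-g w p (no ¬p) = contradiction p ¬p

    g-unfold : ∀ w → g w ≡ proj₁ (next w) g
    g-unfold w = ≡.trans (FixPoint.unfold-wfRec wf (λ _ → X) step step-ext)
                       (proj₁ (proj₂ (next w)) (λ v<w → extend-g w v<w em))

  -- The stages, obtained from ∅ by adding a picked new element and by taking
  -- unions, form a chain; x precedes y when x belongs to the last stage without y.
  module Zermelo (A : Set a) where

    infix 4 _∋_ _⊑_ _≐_

    -- With `Bool`-valued subsets, membership has at most one proof, and predicates of any level
    -- define subsets of the same small type.
    _∋_ : (A → Bool) → A → Set
    P ∋ x = Bool.T (P x)

    _⊑_ _≐_ : Rel (A → Bool) a
    P ⊑ Q = ∀ {x} → P ∋ x → Q ∋ x
    P ≐ Q = P ⊑ Q × Q ⊑ P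

    subset : (A → Set ℓ) → A → Bool
    subset P x = isYes (em {P = P x})

    ∋⁺ : (P : A → Set ℓ) → ∀ {x} → P x → subset P ∋ x
    ∋⁺ P {x} px = fromWitness {a? = em {P = P x}} px

    ∋⁻ : (P : A → Set ℓ) → ∀ {x} → subset P ∋ x → P x
    ∋⁻ P {x} p = toWitness {a? = em {P = P x}} p

    Picks : (A → Bool) → Maybe A → Set a
    Picks P (just x) = Lift a (¬ (P ∋ x))
    Picks P nothing  = ∀ x → P ∋ x

    ≐-setoid : Setoid a a
    ≐-setoid = record
      { Carrier = A → Bool ; _≈_ = _≐_
      ; isEquivalence = record
        { refl = id , id
        ; sym = λ (p , q) → q , p
        ; trans = λ (p , q) (p′ , q′) → p′ ∘ p , q ∘ q′ } }

    picked : Σ[ f ∈ ((A → Bool) → Maybe A) ]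
               (∀ {P Q} → P ≐ Q → f P ≡ f Q) × (∀ P → Picks P (f P))
    picked = choose ≐-setoid Picks
      (λ { {z = just x} (_ , q) (lift ¬p) → lift (¬p ∘ q) ; {z = nothing} (p , _) all x → p (all x) })
      total
      where
      total : ∀ P → Σ (Maybe A) (Picks P)
      total P with em {P = Σ[ x ∈ A ] ¬ (P ∋ x)}
      ... | yes (x , ¬p) = just x , lift ¬p
      ... | no  none     = nothing , λ x → dne (λ ¬p → none (x , ¬p))

    pick = proj₁ picked
    pick-cong = proj₁ (proj₂ picked)

    Next : (A → Bool) → A → Set a
    Next P x = P ∋ x ⊎ pick P ≡ just x

    next : (A → Bool) → A → Bool
    next P = subset (Next P)

    next-∋ : ∀ {P x} → next P ∋ x → Next P x
    next-∋ {P} = ∋⁻ (Next P)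

    ∋-next : ∀ {P x} → Next P x → next P ∋ x
    ∋-next {P} = ∋⁺ (Next P)

    ⊑-next : ∀ {P} → P ⊑ next P
    ⊑-next {P} p = ∋-next {P} (inj₁ p)

    next-mono-≐ : ∀ {P Q} → P ≐ Q → next P ⊑ next Q
    next-mono-≐ {P} {Q} e p with next-∋ {P} p
    ... | inj₁ q = ⊑-next {Q} (proj₁ e q)
    ... | inj₂ eq = ∋-next {Q} (inj₂ (≡.trans (≡.sym (pick-cong e)) eq))

    next-⊑⇒full : ∀ P → next P ⊑ P → ∀ x → P ∋ x
    next-⊑⇒full P sub x = go (pick P) ≡.refl (proj₂ (proj₂ picked) P)
      where
      go : ∀ m → pick P ≡ m → Picks P m → P ∋ x
      go (just y) eq (lift ¬p) = contradiction (sub (∋-next {P} (inj₂ eq))) ¬p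
      go nothing  _  all       = all x

    data Stage : (A → Bool) → Set (Level.suc (Level.suc a)) where
      succ  : ∀ {P Q} → Stage P → next P ≐ Q → Stage Q
      limit : (M : (A → Bool) → Set (Level.suc a)) → (∀ {P} → M P → Stage P) → ∀ {Q} →
              (∀ {P} → M P → P ⊑ Q) → (∀ {x} → Q ∋ x → ∃[ P ] M P × P ∋ x) → Stage Q

    _⋢_ : Rel (A → Bool) a
    P ⋢ Q = Σ[ x ∈ A ] P ∋ x × ¬ (Q ∋ x)

    ⊑? : ∀ P Q → P ⊑ Q ⊎ P ⋢ Q
    ⊑? P Q with em {P = P ⋢ Q}
    ... | yes w = inj₂ w
    ... | no ¬w = inj₁ (λ {x} p → dne (λ ¬q → ¬w (x , p , ¬q)))

    -- The extreme points of the Bourbaki-Witt argument: every stage is comparable with an extreme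
    -- one, and from this every stage turns out to be extreme.
    Extreme : (A → Bool) → Set (Level.suc (Level.suc a))
    Extreme P = ∀ {Q} → Stage Q → Q ⊑ P → P ⋢ Q → next Q ⊑ P

    -- Induction on the stage `Q`. At a successor of some `Q′ ⊑ P`, either `P ⊑ Q′`, so that both
    -- have the same successor, or extremality puts `next Q′` inside `P`.
    extreme-linear : ∀ {P} → Extreme P → ∀ {Q} → Stage Q → Q ⊑ P ⊎ next P ⊑ Q
    extreme-linear {P} ext (succ {Q′} {Q} s (f , b)) with extreme-linear ext s
    ... | inj₂ le = inj₂ (λ p → f (⊑-next {Q′} (le p)))
    ... | inj₁ le with ⊑? P Q′
    ...   | inj₁ ge = inj₂ (λ p → f (next-mono-≐ (ge , le) p))
    ...   | inj₂ lt = inj₁ (λ q → ext s le lt (b q))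
    extreme-linear {P} ext (limit M st {Q} ub cov) with em {P = ∃[ N ] M N × N ⋢ P}
    ... | no none = inj₁ λ q → let (N , m , n) = cov q in
                      dne (λ ¬p → none (N , m , _ , n , ¬p))
    ... | yes (N , m , _ , n , ¬p) with extreme-linear ext (st m)
    ...   | inj₁ le = contradiction (le n) ¬p
    ...   | inj₂ le = inj₂ (λ p → ub m (le p))

    extreme : ∀ {P} → Stage P → Extreme P
    extreme (succ {P′} s (f , b)) t le (x , p , ¬q) with extreme-linear (extreme s) t
    ... | inj₂ ge = contradiction (ge (b p)) ¬q
    ... | inj₁ le′ with ⊑? P′ _
    ...   | inj₁ ge = λ r → f (next-mono-≐ (le′ , ge) r)
    ...   | inj₂ lt = λ r → f (⊑-next {P′} (extreme s t le′ lt r))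
    extreme (limit M st ub cov) t le (x , p , ¬q) with cov p
    ... | N , m , n with extreme-linear (extreme (st m)) t
    ...   | inj₁ le′ = λ r → ub m (extreme (st m) t le′ (x , n , ¬q) r)
    ...   | inj₂ ge = contradiction (ge (⊑-next {N} n)) ¬q

    linear : ∀ {P Q} → Stage P → Stage Q → Q ⊑ P ⊎ next P ⊑ Q
    linear s t = extreme-linear (extreme s) t

    Before : A → (A → Bool) → Set (Level.suc (Level.suc a))
    Before x P = Stage P × ¬ (P ∋ x)

    -- Lowers the universe level so that limit applies to the stages without x.
    Before′ : A → (A → Bool) → Set (Level.suc a)
    Before′ x P = Lift _ (True (em {P = Before x P}))

    Reached : A → A → Set (Level.suc (Level.suc a))
    Reached x y = ∃[ P ] Before x P × P ∋ y

    stage : A → A → Bool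
    stage x = subset (Reached x)

    stage-∋ : ∀ {x y} → stage x ∋ y → Reached x y
    stage-∋ {x} = ∋⁻ (Reached x)

    ∋-stage : ∀ {x y} → Reached x y → stage x ∋ y
    ∋-stage {x} = ∋⁺ (Reached x)

    stage-∌ : ∀ x → ¬ (stage x ∋ x)
    stage-∌ x p with stage-∋ p
    ... | P , (_ , ¬q) , q = ¬q q

    stage-Stage : ∀ x → Stage (stage x)
    stage-Stage x = limit (Before′ x) (λ (lift m) → proj₁ (toWitness m))
      (λ {P} (lift m) p → ∋-stage (P , toWitness m , p))
      (λ q → let (P , m , p) = stage-∋ q in P , lift (fromWitness m) , p)

    -- Otherwise `next (stage x)` is again a stage without `x`, hence contained in `stage x`; then
    -- nothing was left to pick and `stage x` is all of `A`.
    next-stage : ∀ x → next (stage x) ∋ x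
    next-stage x = dne λ ¬p → contradiction
      (next-⊑⇒full (stage x)
        (λ q → ∋-stage (next (stage x) , (succ (stage-Stage x) (id , id) , ¬p) , q)) x)
      (stage-∌ x)

    pick-stage : ∀ x → pick (stage x) ≡ just x
    pick-stage x with next-∋ {stage x} (next-stage x)
    ... | inj₁ p = contradiction p (stage-∌ x)
    ... | inj₂ eq = eq

    _<_ : Rel A a
    x < y = Lift a (stage y ∋ x)

    <-of : ∀ {x y} → next (stage x) ⊑ stage y → x < y
    <-of {x} le = lift (le (next-stage x))

    below : ∀ {P x} → Stage P → P ∋ x → stage x ⊑ P
    below {P} {x} s p with linear s (stage-Stage x)
    ... | inj₁ le = le
    ... | inj₂ ge = contradiction (ge (⊑-next {P} p)) (stage-∌ x)

    -- Induction on stages: when an element is picked at `P`, all its predecessors already belong to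
    -- `P`.
    accessible : ∀ {P} → Stage P → ∀ {x} → P ∋ x → Acc _<_ x
    accessible (succ {P} s (f , b)) {x} p with next-∋ {P} (b p)
    ... | inj₁ q = accessible s q
    ... | inj₂ eq = acc λ {y} (lift y<x) → accessible s (sub y<x)
      where
      sub : stage x ⊑ P
      sub with linear s (stage-Stage x)
      ... | inj₁ le = le
      ... | inj₂ ge = contradiction (ge (∋-next {P} (inj₂ eq))) (stage-∌ x)
    accessible (limit M st ub cov) p with cov p
    ... | P , m , q = accessible (st m) q

    <-compare : Trichotomous _≡_ _<_
    <-compare x y with linear (stage-Stage x) (stage-Stage y) | linear (stage-Stage y) (stage-Stage x)
    ... | inj₂ le | _ = tri< (<-of le) (λ { ≡.refl → stage-∌ x (le (next-stage x)) })
                          (λ (lift y<x) → stage-∌ x (below (stage-Stage x) y<x (le (next-stage x))))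
    ... | inj₁ _ | inj₂ le = tri> (λ (lift x<y) → stage-∌ y (below (stage-Stage y) x<y (le (next-stage y))))
                          (λ { ≡.refl → stage-∌ x (le (next-stage x)) }) (<-of le)
    ... | inj₁ le | inj₁ ge = tri≈ (λ (lift p) → stage-∌ x (le p)) x≡y
                          (λ (lift p) → stage-∌ y (ge p))
      where
      x≡y = Maybe.just-injective
        (≡.trans (≡.sym (pick-stage x)) (≡.trans (pick-cong (ge , le)) (pick-stage y)))

    wellOrder : WellOrder A
    wellOrder = record
      { _<_ = _<_
      ; <-trans = λ {x} {y} {z} (lift x<y) (lift y<z) →
                  lift (below (stage-Stage z) y<z x<y)
      ; compare = <-compare
      ; wellFounded = λ x → accessible (succ (stage-Stage x) (id , id)) (next-stage x)
      ; irrelevant = λ (lift p) (lift q) → ≡.cong lift (T-irrelevant p q)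
      }

  wellOrder : (A : Set a) → WellOrder A
  wellOrder A = Zermelo.wellOrder A

-- Cardinal arithmetic

to : A ↣ B → A → B
to = Injection.to

to-injective : (f : A ↣ B) → ∀ {x y} → to f x ≡ to f y → x ≡ y
to-injective f = Injection.injective f

restrict : {A B : Set a} → WellOrder B → A ↣ B → WellOrder A
restrict {A = A} W f = record
  { _<_ = W._<_ on to f
  ; <-trans = λ {x} {y} {z} → W.<-trans {to f x} {to f y} {to f z}
  ; compare = compare
  ; wellFounded = On.wellFounded (to f) W.wellFounded
  ; irrelevant = W.irrelevant
  }
  where
  module W = WellOrder W
  compare : Trichotomous _≡_ (W._<_ on to f)
  compare x y with W.compare (to f x) (to f y)
  ... | tri< p q r = tri< p (q ∘ ≡.cong (to f)) r
  ... | tri≈ p q r = tri≈ p (to-injective f q) r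
  ... | tri> p q r = tri> p (q ∘ ≡.cong (to f)) r

module _ {A : Set a} (W : WellOrder A) where
  open WellOrder W

  seg↣ : ∀ {x} → Seg x ↣ A
  seg↣ = mk↣ {to = proj₁} seg-injective

  restrictSeg : ∀ x → WellOrder (Seg x)
  restrictSeg x = restrict W (seg↣ {x})

  private
    module R x = WellOrder (restrictSeg x)

  segSeg↣seg : ∀ {x} (y : Seg x) → R.Seg x y ↣ Seg (proj₁ y)
  segSeg↣seg {x} y = mk↣ {to = λ ((z , _) , z<y) → z , z<y}
    λ eq → R.seg-injective x {y} (seg-injective (≡.cong proj₁ eq))

  seg↣segSeg : ∀ {x} (y : Seg x) → Seg (proj₁ y) ↣ R.Seg x y
  seg↣segSeg (y , y<x) = mk↣ {to = λ (z , z<y) → (z , <-trans z<y y<x) , z<y}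
    λ eq → seg-injective (≡.cong (proj₁ ∘ proj₁) eq)

infix 3 _≲_

-- The map need not respect the equality of S; classically it can be replaced by
-- one that does.
record _≲_ (S : Setoid a ℓ) (B : Set b) : Set (a ⊔ ℓ ⊔ b) where
  constructor mk≲
  open Setoid S
  field
    fun       : Carrier → B
    injective : ∀ {x y} → fun x ≡ fun y → x ≈ y

≲-↣ : ∀ {S : Setoid a ℓ} → S ≲ A → A ↣ B → S ≲ B
≲-↣ (mk≲ f f-inj) g = mk≲ (to g ∘ f) (f-inj ∘ to-injective g)

Maybe-↣ : A ↣ B → Maybe A ↣ Maybe B
Maybe-↣ f = mk↣ (Maybe.map-injective (to-injective f))

Maybe-Fin↣ : ∀ {n} → Maybe (Fin n) ↣ Fin (ℕ.suc n)
Maybe-Fin↣ {n} = mk↣ {to = f} inj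
  where
  f : Maybe (Fin n) → Fin (ℕ.suc n)
  f nothing  = zero
  f (just i) = suc i
  inj : ∀ {x y} → f x ≡ f y → x ≡ y
  inj {nothing} {nothing} _ = ≡.refl
  inj {just _} {just _} ≡.refl = ≡.refl

Fin×Fin↣ : ∀ {m n} → (Fin m × Fin n) ↣ Fin (m ℕ.* n)
Fin×Fin↣ = mk↣ {to = λ (i , j) → combine i j}
  λ {(i , j)} {(k , l)} eq →
    let (p , q) = Fin.combine-injective i j k l eq in ≡.cong₂ _,_ p q

ℕ↣̸Fin : ∀ {n} → ¬ (ℕ ↣ Fin n)
ℕ↣̸Fin {n} f = ℕ.1+n≰n (Fin.injective⇒≤ {m = ℕ.suc n}
  (λ eq → Fin.toℕ-injective (to-injective f eq)))

Tuple : Set a → Set a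
Tuple A = ∃[ n ] Vec A n

-- A list is coded by iterated pairing from its last entry, with `nothing` for the empty list; no
-- length need be stored.
tuple↣ : Maybe (A × A) ↣ A → Tuple A ↣ A
tuple↣ {A = A} f = mk↣ {to = λ (_ , v) → enc v} (λ { {_ , v} {_ , w} → inj v w })
  where
  enc : ∀ {n} → Vec A n → A
  enc []       = to f nothing
  enc (x ∷ xs) = to f (just (x , enc xs))
  inj : ∀ {m n} (v : Vec A m) (w : Vec A n) → enc v ≡ enc w →
        _≡_ {A = Tuple A} (m , v) (n , w)
  inj [] [] _ = ≡.refl
  inj [] (_ ∷ _) eq with () ← to-injective f eq
  inj (_ ∷ _) [] eq with () ← to-injective f eq
  inj (x ∷ v) (y ∷ w) eq with to-injective f eq
  ... | eq′ with ≡.cong proj₁ (Maybe.just-injective eq′) | inj v w (≡.cong proj₂ (Maybe.just-injective eq′))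
  ...   | ≡.refl | ≡.refl = ≡.refl

-- The finite substitute for `tuples`: only lists of length at most `n` are told apart, which
-- finitely many codes can do.
boundedTuples : ∀ {k} → A ↣ Fin k → ∀ n → ∃[ m ] Σ[ f ∈ (Tuple A → Fin m) ]
  (∀ {s t} → proj₁ s ℕ.≤ n → proj₁ t ℕ.≤ n → f s ≡ f t → s ≡ t)
boundedTuples _ ℕ.zero = 1 , (λ _ → zero) , λ { {_ , []} {_ , []} z≤n z≤n _ → ≡.refl }
boundedTuples {A = A} {k} e (ℕ.suc n) with boundedTuples e n
... | m , f , f-inj = ℕ.suc (k ℕ.* m) , g , g-inj
  where
  g : Tuple A → Fin (ℕ.suc (k ℕ.* m))
  g (_ , [])     = zero
  g (_ , x ∷ xs) = suc (combine (to e x) (f (_ , xs)))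
  g-inj : ∀ {s t} → proj₁ s ℕ.≤ ℕ.suc n → proj₁ t ℕ.≤ ℕ.suc n → g s ≡ g t → s ≡ t
  g-inj {_ , []} {_ , []} _ _ _ = ≡.refl
  g-inj {_ , x ∷ xs} {_ , y ∷ ys} (s≤s p) (s≤s q) eq
    with Fin.combine-injective _ (f (_ , xs)) _ (f (_ , ys)) (Fin.suc-injective eq)
  ... | eq₁ , eq₂ with to-injective e eq₁ | f-inj p q eq₂
  ...   | ≡.refl | ≡.refl = ≡.refl

Tuple-↣ : A ↣ B → Tuple A ↣ Tuple B
Tuple-↣ {A = A} {B = B} f = mk↣ {to = g} inj
  where
  g : Tuple A → Tuple B
  g (n , xs) = n , Vec.map (to f) xs
  inj : ∀ {s t} → g s ≡ g t → s ≡ t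
  inj {m , xs} {n , ys} eq with ≡.refl ← ≡.cong proj₁ eq =
    ≡.cong (m ,_) (map-inj xs ys (vec eq))
    where
    map-inj : ∀ {n} (xs ys : Vec A n) → Vec.map (to f) xs ≡ Vec.map (to f) ys → xs ≡ ys
    map-inj [] [] _ = ≡.refl
    map-inj (x ∷ xs) (y ∷ ys) eq = let (p , q) = Vec.∷-injective eq in
      ≡.cong₂ _∷_ (to-injective f p) (map-inj xs ys q)
    vec : ∀ {n} {xs ys : Vec B n} → _≡_ {A = Tuple B} (n , xs) (n , ys) → xs ≡ ys
    vec ≡.refl = ≡.refl

-- The set of the Cantor-Bernstein proof: the points reached from outside the image of `j` by
-- iterating `j` after `e`. The bijection is `e` on it and the inverse of `j` elsewhere.
data ForwardOrbit {A : Set a} {B : Set b} (j : A → B) (e : B → A) (x : B) : Set (a ⊔ b) where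
  start : (∀ y → j y ≢ x) → ForwardOrbit j e x
  step  : ∀ {y} → ForwardOrbit j e y → j (e y) ≡ x → ForwardOrbit j e x

module Cardinals (C : Classical) where

  open Choice C

  greedy : {W : Set a} {_<_ : Rel W r} → WellFounded _<_ → Trichotomous _≡_ _<_ →
           (B : Set b) → (W ↣ B) ⊎ Σ[ w ∈ W ] (B ↣ (Σ[ v ∈ W ] v < w))
  greedy {a} {r} {b} {W = W} {_<_} wf compare B = result (em {P = ∃[ w ] g w ≡ nothing})
    where
    R : W → (W → Maybe B) → Maybe B → Set (a ⊔ r ⊔ b)
    R w h (just x) = ∀ {v} → v < w → h v ≢ just x
    R w h nothing  = ∀ x → Σ[ v ∈ W ] v < w × h v ≡ just x
    local : ∀ {w h h′ m} → (∀ {v} → v < w → h v ≡ h′ v) → R w h m → R w h′ m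
    local {m = just x} eq p v<w e = p v<w (≡.trans (eq v<w) e)
    local {m = nothing} eq p x with p x
    ... | v , v<w , e = v , v<w , ≡.trans (≡.sym (eq v<w)) e
    total : ∀ w h → Σ (Maybe B) (R w h)
    total w h with em {P = Σ[ x ∈ B ] (∀ {v} → v < w → h v ≢ just x)}
    ... | yes (x , p) = just x , p
    ... | no none = nothing , λ x → dne λ ¬p → none (x , λ v<w e → ¬p (_ , v<w , e))

    function = recursion wf nothing R local total
    g = proj₁ function
    spec = proj₂ function

    result : Dec (∃[ w ] g w ≡ nothing) → (W ↣ B) ⊎ Σ[ w ∈ W ] (B ↣ (Σ[ v ∈ W ] v < w))
    result (yes (w , eq)) = inj₂ (w , mk↣ {to = λ x → proj₁ (pre x) , proj₁ (proj₂ (pre x))}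
      λ {x} {y} e → Maybe.just-injective
        (≡.trans (≡.sym (proj₂ (proj₂ (pre x)))) (≡.trans (≡.cong (g ∘ proj₁) e) (proj₂ (proj₂ (pre y))))))
      where
      pre : ∀ x → Σ[ v ∈ W ] v < w × g v ≡ just x
      pre = ≡.subst (R w g) eq (spec w)
    result (no never) = inj₁ (mk↣ {to = proj₁ ∘ value} inj)
      where
      defined : ∀ w m → g w ≡ m → Σ[ x ∈ B ] g w ≡ just x
      defined w (just x) eq = x , eq
      defined w nothing  eq = contradiction (w , eq) never
      value : ∀ w → Σ[ x ∈ B ] g w ≡ just x
      value w = defined w (g w) ≡.refl
      fresh : ∀ {v w} → v < w → g v ≢ g w
      fresh {v} {w} v<w eq = ≡.subst (R w g) just-w (spec w) v<w (≡.trans eq just-w)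
        where just-w = proj₂ (value w)
      inj : ∀ {v w} → proj₁ (value v) ≡ proj₁ (value w) → v ≡ w
      inj {v} {w} e with compare v w
                       | ≡.trans (proj₂ (value v)) (≡.trans (≡.cong just e) (≡.sym (proj₂ (value w))))
      ... | tri< v<w _ _ | eq = contradiction eq (fresh v<w)
      ... | tri≈ _ v≡w _ | _  = v≡w
      ... | tri> _ _ w<v | eq = contradiction (≡.sym eq) (fresh w<v)

  infinite⊎finite : (A : Set a) → (ℕ ↣ A) ⊎ (∃[ n ] (A ↣ Fin n))
  infinite⊎finite A with greedy ℕ.<-wellFounded ℕ.<-cmp A
  ... | inj₁ f       = inj₁ f
  ... | inj₂ (n , f) = inj₂ (n , mk↣ {to = λ (i , i<n) → fromℕ< i<n}
    (λ { {i , p} {j , q} e → Σ≡ (Fin.fromℕ<-injective i j p q e) }) ↣-∘ f)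
    where
    Σ≡ : ∀ {i j} {p : i ℕ.< n} {q : j ℕ.< n} → i ≡ j → _≡_ {A = Σ[ i ∈ ℕ ] i ℕ.< n} (i , p) (j , q)
    Σ≡ {i} ≡.refl = ≡.cong (i ,_) (ℕ.<-irrelevant _ _)

  -- Hilbert's hotel: the terms of the sequence `f` move up one place, and `nothing` takes the
  -- first.
  Maybe-absorb : ℕ ↣ A → Maybe A ↣ A
  Maybe-absorb {A = A} f = mk↣ {to = g} inj
    where
    shift : ∀ x → Dec (∃[ n ] to f n ≡ x) → A
    shift x (yes (n , _)) = to f (ℕ.suc n)
    shift x (no _)        = x
    g : Maybe A → A
    g nothing  = to f 0
    g (just x) = shift x em
    zero≢ : ∀ x d → to f 0 ≢ shift x d
    zero≢ x (yes (n , _)) eq with () ← to-injective f eq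
    zero≢ x (no ¬p) eq = ¬p (0 , eq)
    shift-inj : ∀ x y d e → shift x d ≡ shift y e → x ≡ y
    shift-inj x y (yes (n , ≡.refl)) (yes (m , ≡.refl)) eq with to-injective f eq
    ... | ≡.refl = ≡.refl
    shift-inj x y (yes (n , _)) (no ¬q) eq = contradiction (_ , eq) ¬q
    shift-inj x y (no ¬p) (yes (n , _)) eq = contradiction (_ , ≡.sym eq) ¬p
    shift-inj x y (no _) (no _) eq = eq
    inj : ∀ {x y} → g x ≡ g y → x ≡ y
    inj {nothing} {nothing} _ = ≡.refl
    inj {nothing} {just y} eq = contradiction eq (zero≢ y em)
    inj {just x} {nothing} eq = contradiction (≡.sym eq) (zero≢ x em)
    inj {just x} {just y} eq = ≡.cong just (shift-inj x y em em eq)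

  module _ {A : Set a} (W : WellOrder A) where
    open WellOrder W

    private
      infix 4 _≤_
      _≤_ : Rel A a
      x ≤ y = x < y ⊎ x ≡ y

      max : (p : A × A) → Σ[ m ∈ A ] proj₁ p ≤ m × proj₂ p ≤ m
      max (x , y) with compare x y
      ... | tri< x<y _ _ = y , inj₁ x<y , inj₂ ≡.refl
      ... | tri≈ _ x≡y _ = y , inj₂ x≡y , inj₂ ≡.refl
      ... | tri> _ _ y<x = x , inj₂ ≡.refl , inj₁ y<x

      ≤-trans : ∀ {x y z} → x ≤ y → y ≤ z → x ≤ z
      ≤-trans (inj₁ p) (inj₁ q) = inj₁ (<-trans p q)
      ≤-trans (inj₁ p) (inj₂ ≡.refl) = inj₁ p
      ≤-trans (inj₂ ≡.refl) q = q

      toSeg : ∀ {m x} → x ≤ m → Maybe (Seg m)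
      toSeg (inj₁ x<m) = just (_ , x<m)
      toSeg (inj₂ _)   = nothing

      toSeg-injective : ∀ {m x y} (p : x ≤ m) (q : y ≤ m) → toSeg p ≡ toSeg q → x ≡ y
      toSeg-injective (inj₁ _) (inj₁ _) ≡.refl = ≡.refl
      toSeg-injective (inj₂ p) (inj₂ q) _    = ≡.trans p (≡.sym q)

      module P = WellOrder (wellOrder (A × A))

      -- Ordering pairs by their maximum first makes every segment of A × A
      -- embed in the square of a segment of A with one element added.
      key : A × A → A × (A × A)
      key p = proj₁ (max p) , p

      _⊰_ : Rel (A × A) a
      _⊰_ = ×-Lex _≡_ _<_ P._<_ on key

      ⊰-wellFounded : WellFounded _⊰_
      ⊰-wellFounded = On.wellFounded key (×-wellFounded wellFounded P.wellFounded)

      ⊰-compare : Trichotomous _≡_ _⊰_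
      ⊰-compare p q with ×-compare ≡.sym compare P.compare (key p) (key q)
      ... | tri< x y z = tri< x (λ { ≡.refl → y (≡.refl , ≡.refl) }) z
      ... | tri≈ x y z = tri≈ x (proj₂ y) z
      ... | tri> x y z = tri> x (λ { ≡.refl → y (≡.refl , ≡.refl) }) z

      ⊰⇒max≤max : ∀ {p q} → p ⊰ q → proj₁ (max p) ≤ proj₁ (max q)
      ⊰⇒max≤max (inj₁ lt)       = inj₁ lt
      ⊰⇒max≤max (inj₂ (eq , _)) = inj₂ eq

      ⊰-segment↣ : ∀ p → (let S = Seg (proj₁ (max p))) → (Σ[ q ∈ A × A ] q ⊰ p) ↣ (Maybe S × Maybe S)
      ⊰-segment↣ p = mk↣ {to = λ x → toSeg (le₁ x) , toSeg (le₂ x)}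
        λ {x} {y} eq → ⊰-irr (≡.cong₂ _,_ (toSeg-injective (le₁ x) (le₁ y) (≡.cong proj₁ eq))
                                        (toSeg-injective (le₂ x) (le₂ y) (≡.cong proj₂ eq)))
        where
        m = proj₁ (max p)
        le₁ : (x : Σ[ q ∈ A × A ] q ⊰ p) → proj₁ (proj₁ x) ≤ m
        le₁ (q , q⊰p) = ≤-trans (proj₁ (proj₂ (max q))) (⊰⇒max≤max {q} {p} q⊰p)
        le₂ : (x : Σ[ q ∈ A × A ] q ⊰ p) → proj₂ (proj₁ x) ≤ m
        le₂ (q , q⊰p) = ≤-trans (proj₂ (proj₂ (max q))) (⊰⇒max≤max {q} {p} q⊰p)
        lex-irr : ∀ {q} (x y : q ⊰ p) → x ≡ y
        lex-irr (inj₁ x) (inj₁ y) = ≡.cong inj₁ (irrelevant x y)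
        lex-irr (inj₁ x) (inj₂ (eq , _)) = contradiction (≡.subst (_< m) eq x) irrefl
        lex-irr (inj₂ (eq , _)) (inj₁ y) = contradiction (≡.subst (_< m) eq y) irrefl
        lex-irr (inj₂ (e , x)) (inj₂ (e′ , y)) = ≡.cong inj₂ (≡.cong₂ _,_ (uip e e′) (P.irrelevant x y))
          where
          uip : ∀ {x y : A} (e e′ : x ≡ y) → e ≡ e′
          uip ≡.refl ≡.refl = ≡.refl
        ⊰-irr : {x y : Σ[ q ∈ A × A ] q ⊰ p} → proj₁ x ≡ proj₁ y → x ≡ y
        ⊰-irr {q , x} {_ , y} ≡.refl = ≡.cong (q ,_) (lex-irr {q} x y)

    -- If `A` embeds in one of its segments, the hypothesis there suffices. Otherwise a failure
    -- would embed `A` in a segment of `A × A`, so in the square of some `Maybe S` with `S` a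
    -- segment of `A`; then `A` would embed in `S` if `S` is infinite, and would be finite if `S`
    -- is.
    square-step : (∀ x → ℕ ↣ Seg x → (Seg x × Seg x) ↣ Seg x) → ℕ ↣ A → (A × A) ↣ A
    square-step segs f = go em
      where
      go : Dec (Σ[ x ∈ A ] (A ↣ Seg x)) → (A × A) ↣ A
      go (yes (x , g)) = seg↣ W ↣-∘ (segs x (g ↣-∘ f) ↣-∘ (g ×-↣ g))
      go (no initial)  = [ id , (λ (p , g) → ⊥-elim (absurd p (⊰-segment↣ p ↣-∘ g) (infinite⊎finite _))) ]′
                           (greedy ⊰-wellFounded ⊰-compare A)
        where
        absurd : ∀ p → (let S = Seg (proj₁ (max p))) → A ↣ (Maybe S × Maybe S) →
                 (ℕ ↣ S) ⊎ (∃[ n ] (S ↣ Fin n)) → ⊥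
        absurd p g (inj₁ h)       =
          initial (_ , segs _ h ↣-∘ ((Maybe-absorb h ×-↣ Maybe-absorb h) ↣-∘ g))
        absurd p g (inj₂ (n , h)) = ℕ↣̸Fin (Fin×Fin↣ ↣-∘ ((e ×-↣ e) ↣-∘ (g ↣-∘ f)))
          where e = Maybe-Fin↣ ↣-∘ Maybe-↣ h

  square-segments : {A : Set a} (W : WellOrder A) (let open WellOrder W) →
                    ∀ x → ℕ ↣ Seg x → (Seg x × Seg x) ↣ Seg x
  square-segments {A = A} W x = go (wellFounded x)
    where
    open WellOrder W
    go : ∀ {x} → Acc _<_ x → ℕ ↣ Seg x → (Seg x × Seg x) ↣ Seg x
    go {x} (acc rs) = square-step (restrictSeg W x) λ y f →
      seg↣segSeg W y ↣-∘ (go (rs (proj₂ y)) (segSeg↣seg W y ↣-∘ f)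
        ↣-∘ (segSeg↣seg W y ×-↣ segSeg↣seg W y))

  square : ℕ ↣ A → (A × A) ↣ A
  square {A = A} = square-step (wellOrder A) (square-segments (wellOrder A))

  tuples : ℕ ↣ A → Tuple A ↣ A
  tuples f = tuple↣ (Maybe-absorb f ↣-∘ Maybe-↣ (square f))

  ≲⇒Injection : {S : Setoid a ℓ} → S ≲ A → Injection S (≡.setoid A)
  ≲⇒Injection {S = S} (mk≲ f f-inj) = record
    { to = f ∘ rep
    ; cong = ≡.cong f ∘ rep-cong
    ; injective = λ {x} {y} eq → S.trans (S.sym (rep-≈ x)) (S.trans (f-inj eq) (rep-≈ y))
    }
    where
    module S = Setoid S
    rep = proj₁ (representative S)
    rep-cong = proj₁ (proj₂ (representative S))
    rep-≈ = proj₂ (proj₂ (representative S))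

  -- Induction on `n`: a missed value can be removed from the target, and an injection that misses
  -- none is a bijection.
  Infinite⇒⋦Fin : {S : Setoid a ℓ} → Setoid.Carrier S → Infinite S → ∀ {n} → ¬ (S ≲ Fin n)
  Infinite⇒⋦Fin {S = S} s inf {ℕ.zero} S≲Fin with () ← _≲_.fun S≲Fin s
  Infinite⇒⋦Fin {S = S} s inf {ℕ.suc n} S≲Fin
    with em {P = Σ[ i ∈ Fin (ℕ.suc n) ] (∀ x → i ≢ Injection.to (≲⇒Injection S≲Fin) x)}
  ... | yes (i , missed) = Infinite⇒⋦Fin s inf (mk≲ (λ x → punchOut (missed x))
          λ {x} {y} eq → Injection.injective (≲⇒Injection S≲Fin)
            (Fin.punchOut-injective (missed x) (missed y) eq))
  ... | no none = inf (_ , record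
    { to = proj₁ ∘ preimage
    ; cong = λ { ≡.refl → S.refl }
    ; bijective =
        (λ {i} {j} eq → ≡.trans (≡.sym (proj₂ (preimage i))) (≡.trans (f.cong eq) (proj₂ (preimage j))))
      , λ x → f.to x , λ { ≡.refl → f.injective (proj₂ (preimage (f.to x))) }
    })
    where
    module S = Setoid S
    module f = Injection (≲⇒Injection S≲Fin)
    preimage : ∀ i → Σ[ x ∈ S.Carrier ] f.to x ≡ i
    preimage i = dne λ ¬p → none (i , λ x eq → ¬p (x , ≡.sym eq))

  comparable : (A : Set a) (B : Set b) → (A ↣ B) ⊎ (B ↣ A)
  comparable A B with greedy wellFounded compare B
    where open WellOrder (wellOrder A)
  ... | inj₁ f       = inj₁ f
  ... | inj₂ (_ , f) = inj₂ (seg↣ (wellOrder A) ↣-∘ f)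

  -- The number of pairs of tuples over smaller sets is smaller.  When these
  -- sets are finite, that requires bounding the lengths.
  tuples-small : {S : Setoid a ℓ} → Setoid.Carrier S → Infinite S →
    ¬ (S ≲ A) → ¬ (S ≲ B) → (f : S ≲ (Tuple A × Tuple B)) →
    (let open _≲_ f) →
    (∀ x {n} → A ↣ Fin n → proj₁ (proj₁ (fun x)) ℕ.≤ n) →
    (∀ x → proj₁ (proj₂ (fun x)) ℕ.≤ proj₁ (proj₁ (fun x))) → ⊥
  tuples-small {A = A} {B = B} {S = S} s inf S⋦A S⋦B (mk≲ f f-inj) len₁ len₂ =
    -- Both sets embed in the larger of the two, which then serves as `Z`.
    [ (λ e → bound e (↣-id B) S⋦B) , (λ e → bound (↣-id A) e S⋦A) ]′ (comparable A B)
    where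
    bound : {Z : Set ℓ₂} → A ↣ Z → B ↣ Z → ¬ (S ≲ Z) → ⊥
    bound {Z = Z} g h S⋦Z = [ large , small ]′ (infinite⊎finite Z)
      where
      large : ℕ ↣ Z → ⊥
      large i = S⋦Z (≲-↣ (mk≲ f f-inj)
        (square i ↣-∘ ((tuples i ↣-∘ Tuple-↣ g) ×-↣ (tuples i ↣-∘ Tuple-↣ h))))
      small : ∃[ n ] (Z ↣ Fin n) → ⊥
      small (n , e) with boundedTuples (e ↣-∘ g) n | boundedTuples (e ↣-∘ h) n
      ... | _ , p , p-inj | _ , q , q-inj =
        Infinite⇒⋦Fin s inf (≲-↣
          (mk≲ (λ x → p (proj₁ (f x)) , q (proj₂ (f x)))
           λ {x} {y} eq → f-inj (≡.cong₂ _,_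
             (p-inj (l₁ x) (l₁ y) (≡.cong proj₁ eq))
             (q-inj (ℕ.≤-trans (len₂ x) (l₁ x)) (ℕ.≤-trans (len₂ y) (l₁ y)) (≡.cong proj₂ eq))))
          Fin×Fin↣)
        where
        l₁ : ∀ x → proj₁ (proj₁ (f x)) ℕ.≤ n
        l₁ x = len₁ x (e ↣-∘ g)

  -- Plays the role of the cardinal of `S` as an initial ordinal, though `Carrier` is only asked to
  -- be at least as large as `S`.
  record InitialOrder (S : Setoid a a) : Set (Level.suc a) where
    field
      Carrier  : Set a
      order    : WellOrder Carrier
      embed    : S ≲ Carrier
      initial  : ∀ x → ¬ (S ≲ WellOrder.Seg order x)

  initialOrder : (S : Setoid a a) → InitialOrder S
  initialOrder S = go em
    where
    open Setoid S using () renaming (Carrier to X)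
    W = wellOrder X
    open WellOrder W
    go : Dec (Σ[ x ∈ X ] (S ≲ Seg x)) → InitialOrder S
    go (no none) = record
      { Carrier = X ; order = W ; embed = mk≲ id λ { ≡.refl → Setoid.refl S }
      ; initial = λ x p → none (x , p) }
    go (yes some) with minimal wellFounded (λ x → S ≲ Seg x) some
    ... | x , S≲x , least = record
      { Carrier = Seg x ; order = restrictSeg W x ; embed = S≲x
      ; initial = λ y p → least (proj₂ y) (≲-↣ p (segSeg↣seg W y)) }

  cantorBernstein : {B : Set b} {S : Setoid a ℓ} (let module S = Setoid S) → S ≲ B →
                    (e : B → S.Carrier) → (∀ {x y} → e x S.≈ e y → x ≡ y) →
                    Bijection (≡.setoid B) S
  cantorBernstein {b} {a} {B = B} {S = S} S≲B e e-inj = record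
    { to = λ x → f x em
    ; cong = λ { ≡.refl → S.refl }
    ; bijective = (λ {x} {y} → inj em em)
                , λ y → proj₁ (surj y em) , λ { ≡.refl → proj₂ (surj y em) em }
    }
    where
    module S = Setoid S
    module j = Injection (≲⇒Injection S≲B)
    Orbit = ForwardOrbit j.to e
    pre : ∀ {x} → ¬ Orbit x → Σ[ y ∈ S.Carrier ] j.to y ≡ x
    pre ¬o = dne λ ¬p → ¬o (start λ y eq → ¬p (y , eq))
    f : ∀ x → Dec (Orbit x) → S.Carrier
    f x (yes _) = e x
    f x (no ¬o) = proj₁ (pre ¬o)
    inj : ∀ {x y} d d′ → f x d S.≈ f y d′ → x ≡ y
    inj (yes _) (yes _) eq = e-inj eq
    inj (yes o) (no ¬o) eq = contradiction (step o (≡.trans (j.cong eq) (proj₂ (pre ¬o)))) ¬o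
    inj (no ¬o) (yes o) eq = contradiction (step o (≡.trans (j.cong (S.sym eq)) (proj₂ (pre ¬o)))) ¬o
    inj (no ¬o) (no ¬o′) eq = ≡.trans (≡.sym (proj₂ (pre ¬o))) (≡.trans (j.cong eq) (proj₂ (pre ¬o′)))
    surj : ∀ y → Dec (Orbit (j.to y)) → Σ[ x ∈ B ] (∀ d → f x d S.≈ y)
    surj y (yes (start no-pre)) = contradiction ≡.refl (no-pre y)
    surj y (yes (step {x} o eq)) = x , λ { (yes _) → j.injective eq ; (no ¬o) → contradiction o ¬o }
    surj y (no ¬o) = j.to y , λ { (yes o) → contradiction o ¬o ; (no ¬o′) → j.injective (proj₂ (pre ¬o′)) }

-- Bases

lexSum : {A B : Set a} → WellOrder A → WellOrder B → WellOrder (A ⊎ B)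
lexSum {A = A} {B = B} V W = record
  { _<_ = V._<_ ⊎-< W._<_
  ; <-trans = ⊎-<-transitive V.<-trans W.<-trans
  ; compare = compare
  ; wellFounded = ⊎-<-wellFounded V.wellFounded W.wellFounded
  ; irrelevant = λ { ₁∼₂ ₁∼₂ → ≡.refl
                   ; (₁∼₁ p) (₁∼₁ q) → ≡.cong ₁∼₁ (V.irrelevant p q)
                   ; (₂∼₂ p) (₂∼₂ q) → ≡.cong ₂∼₂ (W.irrelevant p q) }
  }
  where
  module V = WellOrder V
  module W = WellOrder W
  compare : Trichotomous _≡_ (V._<_ ⊎-< W._<_)
  compare x y with ⊎-<-trichotomous V.compare W.compare x y
  ... | tri< p q r = tri< p (q ∘ Pointwise.≡⇒Pointwise-≡) r
  ... | tri≈ p q r = tri≈ p (Pointwise.Pointwise-≡⇒≡ q) r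
  ... | tri> p q r = tri> p (q ∘ Pointwise.≡⇒Pointwise-≡) r

module Spans {c d m ℓ} (D : DivisionRing c d) (V : LeftModule (DivisionRing.ring D) m ℓ) where

  private module D = DivisionRing D
  open LeftModule V
  open Sum +ᴹ-commutativeMonoid public
  open SetoidReasoning ≈ᴹ-setoid

  -- Generators may repeat, which makes the closure properties immediate; `combination` later merges
  -- repetitions, by means of `bump`.
  data Span {W : Set a} (f : W → Carrierᴹ) (P : W → Set r) (v : Carrierᴹ)
            : Set (a ⊔ r ⊔ c ⊔ m ⊔ ℓ) where
    nil  : v ≈ᴹ 0ᴹ → Span f P v
    cons : ∀ k {w u} → P w → Span f P u → v ≈ᴹ k *ₗ f w +ᴹ u → Span f P v

  module _ {W : Set a} {f : W → Carrierᴹ} {P : W → Set r} where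

    span-resp : ∀ {u v} → u ≈ᴹ v → Span f P u → Span f P v
    span-resp u≈v (nil u≈0)         = nil (≈ᴹ-trans (≈ᴹ-sym u≈v) u≈0)
    span-resp u≈v (cons k p s u≈) = cons k p s (≈ᴹ-trans (≈ᴹ-sym u≈v) u≈)

    span-generator : ∀ {w} → P w → Span f P (f w)
    span-generator {w} p = cons D.1# p (nil ≈ᴹ-refl) (begin
      f w                  ≈⟨ *ₗ-identityˡ (f w) ⟨
      D.1# *ₗ f w          ≈⟨ +ᴹ-identityʳ _ ⟨
      D.1# *ₗ f w +ᴹ 0ᴹ    ∎)

    span-+ : ∀ {u v} → Span f P u → Span f P v → Span f P (u +ᴹ v)
    span-+ {u} {v} (nil u≈0) t = span-resp (begin
      v         ≈⟨ +ᴹ-identityˡ v ⟨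
      0ᴹ +ᴹ v   ≈⟨ +ᴹ-cong u≈0 ≈ᴹ-refl ⟨
      u +ᴹ v    ∎) t
    span-+ (cons k p s u≈) t = cons k p (span-+ s t)
      (≈ᴹ-trans (+ᴹ-cong u≈ ≈ᴹ-refl) (+ᴹ-assoc _ _ _))

    span-* : ∀ l {u} → Span f P u → Span f P (l *ₗ u)
    span-* l (nil u≈0) = nil (≈ᴹ-trans (*ₗ-cong D.refl u≈0) (*ₗ-zeroʳ l))
    span-* l (cons k {w} {u′} p s u≈) = cons (l D.* k) p (span-* l s) (begin
      l *ₗ _                            ≈⟨ *ₗ-cong D.refl u≈ ⟩
      l *ₗ (k *ₗ f w +ᴹ u′)             ≈⟨ *ₗ-distribˡ l _ _ ⟩
      l *ₗ (k *ₗ f w) +ᴹ l *ₗ u′        ≈⟨ +ᴹ-cong (*ₗ-assoc l k _) ≈ᴹ-refl ⟨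
      (l D.* k) *ₗ f w +ᴹ l *ₗ u′       ∎)

    span-sum : ∀ {n} (t : Fin n → Carrierᴹ) → (∀ i → Span f P (t i)) → Span f P (sum t)
    span-sum {ℕ.zero}  t s = nil ≈ᴹ-refl
    span-sum {ℕ.suc n} t s = span-+ (s zero) (span-sum (t ∘ suc) (s ∘ suc))

  span-trans : {W : Set a} {W′ : Set b} {f : W → Carrierᴹ} {f′ : W′ → Carrierᴹ}
               {P : W → Set r} {P′ : W′ → Set ℓ₁} →
               (∀ {w} → P w → Span f′ P′ (f w)) → ∀ {v} → Span f P v → Span f′ P′ v
  span-trans g (nil v≈0)       = nil v≈0
  span-trans g (cons k p s v≈) = span-resp (≈ᴹ-sym v≈) (span-+ (span-* k (g p)) (span-trans g s))

  bump : ∀ {n} → D.Carrier → Fin n → (Fin n → D.Carrier) → Fin n → D.Carrier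
  bump c zero    k zero    = c D.+ k zero
  bump c zero    k (suc j) = k (suc j)
  bump c (suc i) k zero    = k zero
  bump c (suc i) k (suc j) = bump c i (k ∘ suc) j

  sum-bump : ∀ {n} c (i : Fin n) k (y : Fin n → Carrierᴹ) →
             sum (λ j → bump c i k j *ₗ y j) ≈ᴹ c *ₗ y i +ᴹ sum (λ j → k j *ₗ y j)
  sum-bump c zero k y = begin
    (c D.+ k zero) *ₗ y zero +ᴹ s          ≈⟨ +ᴹ-cong (*ₗ-distribʳ _ c _) ≈ᴹ-refl ⟩
    c *ₗ y zero +ᴹ k zero *ₗ y zero +ᴹ s   ≈⟨ +ᴹ-assoc _ _ _ ⟩
    c *ₗ y zero +ᴹ (k zero *ₗ y zero +ᴹ s) ∎
    where s = sum (λ j → k (suc j) *ₗ y (suc j))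
  sum-bump c (suc i) k y = begin
    t +ᴹ sum (λ j → bump c i (k ∘ suc) j *ₗ y (suc j))
      ≈⟨ +ᴹ-cong ≈ᴹ-refl (sum-bump c i (k ∘ suc) (y ∘ suc)) ⟩
    t +ᴹ (u +ᴹ s)   ≈⟨ +ᴹ-assoc _ _ _ ⟨
    t +ᴹ u +ᴹ s     ≈⟨ +ᴹ-cong (+ᴹ-comm t u) ≈ᴹ-refl ⟩
    u +ᴹ t +ᴹ s     ≈⟨ +ᴹ-assoc _ _ _ ⟩
    u +ᴹ (t +ᴹ s)   ∎
    where
    t = k zero *ₗ y zero
    u = c *ₗ y (suc i)
    s = sum (λ j → k (suc j) *ₗ y (suc j))

  record Combination {W : Set a} (f : W → Carrierᴹ) (P : W → Set r) (v : Carrierᴹ)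
                     : Set (a ⊔ r ⊔ c ⊔ m ⊔ ℓ) where
    field
      {size}    : ℕ
      point     : Fin size → W
      distinct  : Injective _≡_ _≡_ point
      allowed   : ∀ i → P (point i)
      coeff     : Fin size → D.Carrier
      equation  : v ≈ᴹ sum (λ i → coeff i *ₗ f (point i))

  module Bases (C : Classical) where

    open Choice C
    open Cardinals C

    combination : {W : Set a} {f : W → Carrierᴹ} {P : W → Set r} →
                  ∀ {v} → Span f P v → Combination f P v
    combination (nil v≈0) = record
      { size = 0 ; point = λ () ; distinct = λ { {()} } ; allowed = λ () ; coeff = λ () ; equation = v≈0 }
    combination {W = W} {f} {P} {v} (cons k {w} {u} p s v≈) = insert (combination s)
      where
      insert : Combination f P u → Combination f P v
      insert comb with em {P = Σ[ i ∈ Fin (Combination.size comb) ] Combination.point comb i ≡ w}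
      ... | yes (i , eq) = record
        { point = point ; distinct = distinct ; allowed = allowed ; coeff = bump k i coeff
        ; equation = begin
            v                     ≈⟨ v≈ ⟩
            k *ₗ f w +ᴹ u         ≈⟨ +ᴹ-cong (≈ᴹ-reflexive (≡.cong (λ z → k *ₗ f z) (≡.sym eq))) equation ⟩
            k *ₗ f (point i) +ᴹ _ ≈⟨ sum-bump k i coeff (f ∘ point) ⟨
            _                     ∎
        }
        where open Combination comb
      ... | no new = record
        { point = w Vector.∷ point
        ; distinct = λ { {zero} {zero} _ → ≡.refl
                       ; {zero} {suc j} eq → contradiction (j , ≡.sym eq) new
                       ; {suc i} {zero} eq → contradiction (i , eq) new
                       ; {suc i} {suc j} eq → ≡.cong suc (distinct eq) }
        ; allowed = λ { zero → p ; (suc i) → allowed i }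
        ; coeff = k Vector.∷ coeff
        ; equation = ≈ᴹ-trans v≈ (+ᴹ-cong ≈ᴹ-refl equation)
        }
        where open Combination comb

    maximum : {W : Set a} (O : WellOrder W) (let open WellOrder O) →
              ∀ {n} (x : Fin n → W) (Q : Fin n → Set r) → Σ (Fin n) Q →
              Σ[ j ∈ Fin n ] Q j × (∀ i → Q i → ¬ (x j < x i))
    maximum O {ℕ.suc n} x Q some with em {P = Σ[ i ∈ Fin n ] Q (suc i)}
    ... | no none = zero , first some , λ { zero _ → irrefl ; (suc i) q → contradiction (i , q) none }
      where
      open WellOrder O
      first : Σ (Fin (ℕ.suc n)) Q → Q zero
      first (zero , q) = q
      first (suc i , q) = contradiction (i , q) none
    ... | yes some′ with maximum O (x ∘ suc) (Q ∘ suc) some′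
    ...   | j , q , max with em {P = Q zero × WellOrder._<_ O (x (suc j)) (x zero)}
    ...     | yes (q₀ , lt) = zero , q₀ ,
                λ { zero _ → irrefl ; (suc i) q′ lt′ → max i q′ (<-trans lt lt′) }
      where open WellOrder O
    ...     | no ¬lt = suc j , q , λ { zero q₀ lt → ¬lt (q₀ , lt) ; (suc i) → max i }

    -- Discarding every vector that lies in the span of its predecessors leaves a basis.
    module Greedy {W : Set a} (O : WellOrder W) (f : W → Carrierᴹ)
                  (onto : ∀ v → Σ[ w ∈ W ] f w ≈ᴹ v) where

      open WellOrder O

      New : W → Set (a ⊔ c ⊔ m ⊔ ℓ)
      New w = ¬ Span f (_< w) (f w)

      -- `True` of the decision gives newness at most one proof and keeps the index set at the level
      -- of `W`.
      Index : Set a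
      Index = Σ[ w ∈ W ] True (em {P = New w})

      new : (x : Index) → New (proj₁ x)
      new (w , t) = toWitness t

      index-≡ : {x y : Index} → proj₁ x ≡ proj₁ y → x ≡ y
      index-≡ {w , s} {_ , t} ≡.refl = ≡.cong (w ,_) (True-irrelevant em s t)
        where
        True-irrelevant : {Q : Set r} (d : Dec Q) (s t : True d) → s ≡ t
        True-irrelevant (yes _) _ _ = ≡.refl

      vector : Index → Carrierᴹ
      vector = f ∘ proj₁

      vector-injective : ∀ {x y} → vector x ≈ᴹ vector y → x ≡ y
      vector-injective {x} {y} eq with compare (proj₁ x) (proj₁ y)
      ... | tri< x<y _ _ = contradiction (span-resp eq (span-generator x<y)) (new y)
      ... | tri≈ _ x≡y _ = index-≡ x≡y
      ... | tri> _ _ y<x = contradiction (span-resp (≈ᴹ-sym eq) (span-generator y<x)) (new x)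

      span-new : ∀ w → Span f New (f w)
      span-new w = go (wellFounded w)
        where
        go : ∀ {w} → Acc _<_ w → Span f New (f w)
        go {w} (acc rs) = aux em
          where
          aux : Dec (Span f (_< w) (f w)) → Span f New (f w)
          aux (yes s) = span-trans (λ v<w → go (rs v<w)) s
          aux (no ¬s) = span-generator ¬s

      private
        solve : ∀ {k y} {u v} → y D.* k D.≈ D.1# → k *ₗ u +ᴹ v ≈ᴹ 0ᴹ → (D.- y) *ₗ v ≈ᴹ u
        solve {k} {y} {u} {v} yk≈1 eq = begin
          z *ₗ v                                   ≈⟨ +ᴹ-identityˡ _ ⟨
          0ᴹ +ᴹ z *ₗ v                             ≈⟨ +ᴹ-cong (*ₗ-zeroʳ y) ≈ᴹ-refl ⟨
          y *ₗ 0ᴹ +ᴹ z *ₗ v                        ≈⟨ +ᴹ-cong (*ₗ-cong D.refl eq) ≈ᴹ-refl ⟨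
          y *ₗ (k *ₗ u +ᴹ v) +ᴹ z *ₗ v             ≈⟨ +ᴹ-cong (*ₗ-distribˡ y _ _) ≈ᴹ-refl ⟩
          (y *ₗ (k *ₗ u) +ᴹ y *ₗ v) +ᴹ z *ₗ v      ≈⟨ +ᴹ-assoc _ _ _ ⟩
          y *ₗ (k *ₗ u) +ᴹ (y *ₗ v +ᴹ z *ₗ v)      ≈⟨ +ᴹ-cong (*ₗ-assoc y k u) (*ₗ-distribʳ v y z) ⟨
          (y D.* k) *ₗ u +ᴹ (y D.+ z) *ₗ v
            ≈⟨ +ᴹ-cong (*ₗ-cong yk≈1 ≈ᴹ-refl) (*ₗ-cong (D.-‿inverseʳ y) ≈ᴹ-refl) ⟩
          D.1# *ₗ u +ᴹ D.0# *ₗ v                   ≈⟨ +ᴹ-cong (*ₗ-identityˡ u) (*ₗ-zeroˡ v) ⟩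
          u +ᴹ 0ᴹ                                  ≈⟨ +ᴹ-identityʳ u ⟩
          u                                        ∎
          where z = D.- y

      -- In a nontrivial relation, take the largest index with nonzero coefficient. Solving for its
      -- vector puts it in the span of its predecessors, so it is not new.
      independent : ∀ {n} (x : Fin n → Index) → Injective _≡_ _≡_ x → (k : Fin n → D.Carrier) →
                    sum (λ j → k j *ₗ vector (x j)) ≈ᴹ 0ᴹ → ∀ j → k j D.≈ D.0#
      independent {ℕ.suc n} x x-inj k eq j = dne λ kj≉0 →
        absurd (maximum O (proj₁ ∘ x) (λ i → ¬ (k i D.≈ D.0#)) (j , kj≉0))
        where
        absurd : Σ[ i ∈ Fin (ℕ.suc n) ] ¬ (k i D.≈ D.0#) ×
                 (∀ i′ → ¬ (k i′ D.≈ D.0#) → ¬ (proj₁ (x i) < proj₁ (x i′))) → ⊥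
        absurd (i , ki≉0 , max) = new (x i) (span-resp
          (solve (proj₁ (proj₂ (D.invertible (k i) ki≉0)))
                 (≈ᴹ-trans (≈ᴹ-sym (sum-remove (λ j → k j *ₗ vector (x j)))) eq))
          (span-* _ (span-sum _ (λ j′ → term (punchIn i j′) (Fin.punchInᵢ≢i i j′) em))))
          where
          term : ∀ j′ → j′ ≢ i → Dec (k j′ D.≈ D.0#) → Span f (_< proj₁ (x i)) (k j′ *ₗ vector (x j′))
          term j′ _ (yes k≈0) = nil (≈ᴹ-trans (*ₗ-cong k≈0 ≈ᴹ-refl) (*ₗ-zeroˡ _))
          term j′ j′≢i (no k≉0) with compare (proj₁ (x j′)) (proj₁ (x i))
          ... | tri< lt _ _ = span-* _ (span-generator lt)
          ... | tri≈ _ e _  = contradiction (x-inj (index-≡ e)) j′≢i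
          ... | tri> _ _ gt = contradiction gt (max j′ k≉0)

      isBasis : Basis.IsBasis D.ring +ᴹ-rawMonoid _*ₗ_ (≡.setoid Index) vector
      isBasis = record
        { congruent = λ { ≡.refl → ≈ᴹ-refl }
        ; linearlyIndependent = independent
        ; spanning = λ v → let open Combination (combination (span-new (proj₁ (onto v)))) in
            size , (λ i → point i , fromWitness (allowed i)) , coeff ,
            ≈ᴹ-trans (≈ᴹ-sym (proj₂ (onto v))) equation
        }

-- From an independent family to the dimension

module _ (C : Classical) (D : DivisionRing ℓ ℓ) (V : LeftModule (DivisionRing.ring D) ℓ ℓ) where

  private module D = DivisionRing D
  open LeftModule V
  open Spans D V
  open Bases C
  open Choice C
  open Cardinals C

  -- A basis containing the family `g` is at least as large as `D`. Vectors are then coded by finite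
  -- sequences of pairs of basis indices, one index standing for the coefficient, and there are no
  -- more such sequences than indices.
  dimension≡cardinality : Infinite D.setoid → {X : Set ℓ} (O : WellOrder X) (let open WellOrder O) →
    D.setoid ≲ X → (g : X → Carrierᴹ) → (∀ x → ¬ Span g (_< x) (g x)) →
    HasLeftDimension V ≈ᴹ-setoid
  dimension≡cardinality D-infinite {X} O D≲X g g-new =
    ≡.setoid Index , vector , isBasis , cantorBernstein V≲Index vector vector-injective
    where
    f : X ⊎ Carrierᴹ → Carrierᴹ
    f = [ g , id ]′
    -- The family comes before all other vectors, so only earlier members of it could make `g x`
    -- redundant, and all of `X` survives.
    open Greedy (lexSum O (wellOrder Carrierᴹ)) f (λ v → inj₂ v , ≈ᴹ-refl)

    X↣Index : X ↣ Index
    X↣Index = mk↣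
      {to = λ x → inj₁ x , fromWitness (λ s →
        g-new x (span-trans (λ { (₁∼₁ lt) → span-generator lt }) s))}
      λ { ≡.refl → ≡.refl }

    D≲Index : D.setoid ≲ Index
    D≲Index = ≲-↣ D≲X X↣Index

    infinite : ℕ ↣ Index
    infinite = [ id , (λ (_ , e) → contradiction (≲-↣ D≲Index e) (Infinite⇒⋦Fin D.0# D-infinite)) ]′
                 (infinite⊎finite Index)

    open Basis.IsBasis isBasis using (spanning)
    open _≲_ D≲Index using (fun; injective)

    points : ∀ v → Fin (proj₁ (spanning v)) → Index
    points v = proj₁ (proj₂ (spanning v))

    coeffs : ∀ v → Fin (proj₁ (spanning v)) → D.Carrier
    coeffs v = proj₁ (proj₂ (proj₂ (spanning v)))

    encode : Carrierᴹ → Tuple (Index × Index)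
    encode v = _ , Vec.tabulate (λ i → fun (coeffs v i) , points v i)

    same : ∀ {n n′} (x : Fin n → Index) (x′ : Fin n′ → Index)
           (k : Fin n → D.Carrier) (k′ : Fin n′ → D.Carrier) →
           _≡_ {A = Tuple (Index × Index)} (n , Vec.tabulate (λ i → fun (k i) , x i))
                                           (n′ , Vec.tabulate (λ i → fun (k′ i) , x′ i)) →
           sum (λ i → k i *ₗ vector (x i)) ≈ᴹ sum (λ i → k′ i *ₗ vector (x′ i))
    same {n} x x′ k k′ eq with ≡.refl ← ≡.cong proj₁ eq = sum-cong-≋ λ i →
      *ₗ-cong (injective {k i} {k′ i} (≡.cong proj₁ (at i))) (≈ᴹ-reflexive (≡.cong (vector ∘ proj₂) (at i)))
      where
      vec : ∀ {n} {xs ys : Vec (Index × Index) n} →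
            _≡_ {A = Tuple (Index × Index)} (n , xs) (n , ys) → xs ≡ ys
      vec ≡.refl = ≡.refl
      at : ∀ i → (fun (k i) , x i) ≡ (fun (k′ i) , x′ i)
      at i = ≡.trans (≡.sym (Vec.lookup∘tabulate _ i))
               (≡.trans (≡.cong (λ xs → Vec.lookup xs i) (vec eq)) (Vec.lookup∘tabulate _ i))

    V≲Index : ≈ᴹ-setoid ≲ Index
    V≲Index = ≲-↣ (mk≲ encode λ {u} {v} eq →
        ≈ᴹ-trans (proj₂ (proj₂ (proj₂ (spanning u))))
          (≈ᴹ-trans (same (points u) (points v) (coeffs u) (coeffs v) eq)
            (≈ᴹ-sym (proj₂ (proj₂ (proj₂ (spanning v)))))))
      (tuples infinite ↣-∘ Tuple-↣ (square infinite))

-- The independent family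

module _ (C : Classical) (D : DivisionRing a ℓ) where

  open Choice C
  open DivisionRing D hiding (zero)
  open SemiringSum semiring
  open GroupProperties +-group using () renaming (x∙y⁻¹≈ε⇒x≈y to x-y≈0⇒x≈y)
  open SetoidReasoning setoid

  private
    cancel : ∀ x y → y + (x - y) ≈ x
    cancel x y = begin
      y + (x - y)       ≈⟨ +-comm y _ ⟩
      (x - y) + y       ≈⟨ +-assoc x (- y) y ⟩
      x + (- y + y)     ≈⟨ +-congˡ (-‿inverseˡ y) ⟩
      x + 0#            ≈⟨ +-identityʳ x ⟩
      x                 ∎

  -- The bookkeeping of column elimination: correcting the coefficients `d` by `e` times `t` is
  -- compensated by `t` times the column with coefficients `e`.
  sum-affine : ∀ {n} (u d e : Fin n → Carrier) t →
               sum (λ k → u k * (d k - e k * t)) + sum (λ k → u k * e k) * t ≈ sum (λ k → u k * d k)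
  sum-affine u d e t = begin
    sum (λ k → u k * (d k - e k * t)) + sum (λ k → u k * e k) * t
      ≈⟨ +-congˡ (*-distribʳ-sum t (λ k → u k * e k)) ⟩
    sum (λ k → u k * (d k - e k * t)) + sum (λ k → u k * e k * t)
      ≈⟨ ∑-distrib-+ (λ k → u k * (d k - e k * t)) (λ k → u k * e k * t) ⟨
    sum (λ k → u k * (d k - e k * t) + u k * e k * t)
      ≈⟨ sum-cong-≋ (λ k → trans (+-congˡ (*-assoc (u k) (e k) t))
           (trans (sym (distribˡ (u k) _ _)) (*-congˡ (trans (+-comm _ _) (cancel (d k) (e k * t)))))) ⟩
    sum (λ k → u k * d k) ∎

  -- The columns (b j x)ⱼ, for x in S, span a right vector space of dimension at most m.
  spanningColumns : ∀ {S : Set b} m (b : Fin m → S → Carrier) →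
    ∃[ r ] r ℕ.≤ m × Σ[ p ∈ (Fin r → S) ]
      (∀ x → Σ[ d ∈ (Fin r → Carrier) ] (∀ j → b j x ≈ sum (λ k → b j (p k) * d k)))
  spanningColumns ℕ.zero b = 0 , z≤n , (λ ()) , λ _ → (λ ()) , λ ()
  spanningColumns {S = S} (ℕ.suc m) b with spanningColumns m (b ∘ suc)
  ... | r , r≤m , p , sol = go em
    where
    d : S → Fin r → Carrier
    d x = proj₁ (sol x)
    ∑₀ : S → Carrier
    ∑₀ x = sum (λ k → b zero (p k) * d x k)
    go : Dec (Σ[ y ∈ S ] ¬ (b zero y ≈ ∑₀ y)) → _
    go (no none) = r , ℕ.≤-trans r≤m (ℕ.n≤1+n m) , p ,
      λ x → d x , λ { zero → dne (λ ¬eq → none (x , ¬eq)) ; (suc j) → proj₂ (sol x) j }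
    go (yes (y , y-new)) = ℕ.suc r , s≤s r≤m , y Vector.∷ p , λ x → d′ x , eq x
      where
      -- `e x` is the error of the old coefficients in row zero. The new column `y` enters with the
      -- factor `t x` that turns its error into that of `x`; subtracting `d y k * t x` keeps the
      -- other rows valid.
      e : S → Carrier
      e x = b zero x - ∑₀ x
      inverse = invertible (e y) (y-new ∘ x-y≈0⇒x≈y _ _)
      t : S → Carrier
      t x = proj₁ inverse * e x
      d′ : S → Fin (ℕ.suc r) → Carrier
      d′ x = t x Vector.∷ λ k → d x k - d y k * t x
      rest : S → Fin (ℕ.suc m) → Carrier
      rest x j = sum (λ k → b j (p k) * (d x k - d y k * t x))
      et : ∀ x → e y * t x ≈ e x
      et x = begin
        e y * (proj₁ inverse * e x)  ≈⟨ *-assoc _ _ _ ⟨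
        e y * proj₁ inverse * e x    ≈⟨ *-congʳ (proj₂ (proj₂ inverse)) ⟩
        1# * e x                     ≈⟨ *-identityˡ _ ⟩
        e x                          ∎
      eq : ∀ x j → b j x ≈ b j y * t x + rest x j
      eq x zero = begin
        b zero x                                ≈⟨ cancel _ (∑₀ x) ⟨
        ∑₀ x + e x
          ≈⟨ +-congʳ (sum-affine (λ k → b zero (p k)) (d x) (d y) (t x)) ⟨
        rest x zero + ∑₀ y * t x + e x          ≈⟨ +-assoc _ _ _ ⟩
        rest x zero + (∑₀ y * t x + e x)        ≈⟨ +-congˡ (+-congˡ (et x)) ⟨
        rest x zero + (∑₀ y * t x + e y * t x)  ≈⟨ +-congˡ (distribʳ (t x) _ _) ⟨
        rest x zero + (∑₀ y + e y) * t x        ≈⟨ +-congˡ (*-congʳ (cancel _ (∑₀ y))) ⟩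
        rest x zero + b zero y * t x            ≈⟨ +-comm _ _ ⟩
        b zero y * t x + rest x zero            ∎
      eq x (suc j) = begin
        b (suc j) x                             ≈⟨ proj₂ (sol x) j ⟩
        sum (λ k → b (suc j) (p k) * d x k)     ≈⟨ sum-affine (λ k → b (suc j) (p k)) (d x) (d y) (t x) ⟨
        rest x (suc j) + sum (λ k → b (suc j) (p k) * d y k) * t x ≈⟨ +-congˡ (*-congʳ (proj₂ (sol y) j)) ⟨
        rest x (suc j) + b (suc j) y * t x      ≈⟨ +-comm _ _ ⟩
        b (suc j) y * t x + rest x (suc j)      ∎

module Family (C : Classical) (D : DivisionRing ℓ ℓ) (D-infinite : Infinite (DivisionRing.setoid D)) where

  open Choice C
  open Cardinals C
  open DivisionRing D hiding (zero) renaming (Carrier to K)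
  open SemiringSum semiring
  open SetoidReasoning setoid

  open InitialOrder (initialOrder setoid) public renaming (Carrier to X)
  open WellOrder order

  private
    weighted-cong : ∀ {n} {u v : Fin n → K} (d : Fin n → K) → (∀ k → u k ≈ v k) →
                    sum (λ k → u k * d k) ≈ sum (λ k → v k * d k)
    weighted-cong d u≈v = sum-cong-≋ (λ k → *-congʳ (u≈v k))

    -- The sequences of the a_j below a and of the x_k below x.
    Code : X × X → Set ℓ
    Code (a , x) = Tuple (Seg a) × Tuple (Seg x)

    Solution : ∀ {p} → (X × X → K) → (c : Code p) → (Fin (proj₁ (proj₂ c)) → K) → Set ℓ
    Solution {a , x} h ((_ , J) , (_ , P)) d = ∀ i →
      h (proj₁ (Vec.lookup J i) , x) ≈
      sum (λ k → h (proj₁ (Vec.lookup J i) , proj₁ (Vec.lookup P k)) * d k)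

    value : ∀ {p} → (X × X → K) → (c : Code p) → (Fin (proj₁ (proj₂ c)) → K) → K
    value {a , x} h (_ , (_ , P)) d = sum (λ k → h (a , proj₁ (Vec.lookup P k)) * d k)

    -- Over finite segments there are still infinitely many tuples, so the lengths must be limited.
    -- Distinct rows and a minimal set of columns meet both bounds.
    Bounded : ∀ {p} → Code p → Set ℓ
    Bounded {a , x} ((n , _) , (r , _)) = (∀ {k} → Seg a ↣ Fin k → n ℕ.≤ k) × r ℕ.≤ n

    -- Says that `t` is not forced, with the negation moved inward.
    Avoids : X × X → (X × X → K) → K → Set ℓ
    Avoids p h t = (c : Code p) → Bounded c → Σ _ (Solution h c) →
                   Σ _ λ d → Solution h c d × ¬ (t ≈ value h c d)

    _≪_ : X × X → X × X → Set ℓ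
    _≪_ = ×-Lex _≡_ _<_ _<_

    -- The systems at `(a , x)` involve only entries in rows below `a`, and entries of row `a` in
    -- columns below `x`; all precede `(a , x)`.
    local : ∀ {p h h′ t} → (∀ {q} → q ≪ p → h q ≡ h′ q) → Avoids p h t → Avoids p h′ t
    local {a , x} {h} {h′} agree avoids c@((_ , J) , (_ , P)) bounded (d , sol) =
      let (e , sol′ , t≉) = avoids c bounded
            (d , λ i → trans (earlier i {x}) (trans (sol i) (sym (columns i d)))) in
      e , (λ i → trans (sym (earlier i {x})) (trans (sol′ i) (columns i e)))
        , λ eq → t≉ (trans eq (sym (weighted-cong e (λ k →
            reflexive (agree (inj₂ (≡.refl , proj₂ (Vec.lookup P k))))))))
      where
      earlier : ∀ i {y} → h (proj₁ (Vec.lookup J i) , y) ≈ h′ (proj₁ (Vec.lookup J i) , y)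
      earlier i = reflexive (agree (inj₁ (proj₂ (Vec.lookup J i))))
      columns : ∀ i d → sum (λ k → h (proj₁ (Vec.lookup J i) , proj₁ (Vec.lookup P k)) * d k) ≈
                 sum (λ k → h′ (proj₁ (Vec.lookup J i) , proj₁ (Vec.lookup P k)) * d k)
      columns i d = weighted-cong d (λ k → earlier i {proj₁ (Vec.lookup P k)})

    module _ (p : X × X) (h : X × X → K) where

      Forced : K → Code p → Set ℓ
      Forced t c = Bounded c × Σ _ (Solution h c) × (∀ d → Solution h c d → t ≈ value h c d)

      forced-unique : ∀ {t t′ c c′} → c ≡ c′ → Forced t c → Forced t′ c′ → t ≈ t′
      forced-unique ≡.refl (_ , (d , sol) , t≈) (_ , _ , t′≈) = trans (t≈ d sol) (sym (t′≈ d sol))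

      -- A code forces at most one value. If every element of the ring were forced, the ring would
      -- embed in the bounded codes, of which there are too few.
      total : Σ K (Avoids p h)
      total with em {P = Σ[ t ∈ K ] ¬ Σ (Code p) (Forced t)}
      ... | yes (t , free) = t , λ c bounded solvable → dne λ none →
              free (c , bounded , solvable , λ d sol → dne λ t≉ → none (d , sol , t≉))
      ... | no none = ⊥-elim
              (tuples-small 0# D-infinite (initial (proj₁ p)) (initial (proj₂ p))
                (mk≲ (proj₁ ∘ code) λ {t} {t′} eq → forced-unique eq (proj₂ (code t)) (proj₂ (code t′)))
                (λ t → proj₁ (proj₁ (proj₂ (code t))))
                (λ t → proj₂ (proj₁ (proj₂ (code t)))))
        where
        code : ∀ t → Σ (Code p) (Forced t)
        code t = dne λ ¬forced → none (t , ¬forced)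

    abstract
      family : Σ[ h ∈ (X × X → K) ] (∀ p → Avoids p h (h p))
      family = recursion (×-wellFounded wellFounded wellFounded) 0# Avoids local total

  g : X → X → K
  g a x = proj₁ family (a , x)

  private
    above : (S : X → Set ℓ) → Σ X S → (∀ {x} → S x → Σ[ y ∈ X ] S y × x < y) →
            ∀ {n} (p : Fin n → Σ X S) → Σ[ y ∈ X ] S y × (∀ k → proj₁ (p k) < y)
    above S (x , sx) unbounded {ℕ.zero} p = x , sx , λ ()
    above S some unbounded {ℕ.suc n} p with above S some unbounded (p ∘ suc)
    ... | y , sy , p<y with compare (proj₁ (p zero)) y | unbounded (proj₂ (p zero))
    ...   | tri< lt _ _ | _ = y , sy , λ { zero → lt ; (suc k) → p<y k }
    ...   | tri≈ _ eq _ | z , sz , lt = z , sz ,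
              λ { zero → lt ; (suc k) → <-trans (p<y k) (≡.subst (_< z) eq lt) }
    ...   | tri> _ _ gt | z , sz , lt = z , sz ,
              λ { zero → lt ; (suc k) → <-trans (p<y k) (<-trans gt lt) }

  g-independent : ∀ {a n} (J : Fin n → X) → Injective _≡_ _≡_ J → (∀ i → J i < a) →
    (c : Fin n → K) (S : X → Set ℓ) → Σ X S → (∀ {x} → S x → Σ[ y ∈ X ] S y × x < y) →
    ¬ (∀ {x} → S x → g a x ≈ sum (λ i → c i * g (J i) x))
  g-independent {a} {n} J J-inj J<a c S some unbounded relation
    with spanningColumns C D n (λ i (x : Σ X S) → g (J i) (proj₁ x))
  ... | r , r≤n , p , sol with above S some unbounded p
  ...   | y , sy , p<y =
    absurd (proj₂ family (a , y) code (bounded , r≤n) (proj₁ (sol (y , sy)) , solution))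
    where
    Js : Fin n → Seg a
    Js i = J i , J<a i
    Ps : Fin r → Seg y
    Ps k = proj₁ (p k) , p<y k
    code : Code (a , y)
    code = (n , Vec.tabulate Js) , (r , Vec.tabulate Ps)
    bounded : ∀ {k} → Seg a ↣ Fin k → n ℕ.≤ k
    bounded f = Fin.injective⇒≤ {f = to f ∘ Js} (J-inj ∘ ≡.cong proj₁ ∘ to-injective f)
    at-J : ∀ i → proj₁ (Vec.lookup (Vec.tabulate Js) i) ≡ J i
    at-J i = ≡.cong proj₁ (Vec.lookup∘tabulate Js i)
    at-P : ∀ k → proj₁ (Vec.lookup (Vec.tabulate Ps) k) ≡ proj₁ (p k)
    at-P k = ≡.cong proj₁ (Vec.lookup∘tabulate Ps k)
    fromCode : ∀ (d : Fin r → K) i →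
      sum (λ k → g (proj₁ (Vec.lookup (Vec.tabulate Js) i)) (proj₁ (Vec.lookup (Vec.tabulate Ps) k)) * d k) ≈
      sum (λ k → g (J i) (proj₁ (p k)) * d k)
    fromCode d i = weighted-cong d (λ k → reflexive (≡.cong₂ g (at-J i) (at-P k)))
    solution : Solution (proj₁ family) code (proj₁ (sol (y , sy)))
    solution i = trans (reflexive (≡.cong (λ j → g j y) (at-J i)))
      (trans (proj₂ (sol (y , sy)) i) (sym (fromCode _ i)))
    absurd : (Σ _ λ d → Solution (proj₁ family) code d × ¬ (g a y ≈ value (proj₁ family) code d)) → ⊥
    -- This solution need not be the one found above, but the relation gives every solution the
    -- value `g a y`.
    absurd (d , sol′ , avoided) = avoided (begin
      g a y
        ≈⟨ relation sy ⟩
      sum (λ i → c i * g (J i) y)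
        ≈⟨ sum-cong-≋ (λ i → *-congˡ (trans (reflexive (≡.cong (λ j → g j y) (≡.sym (at-J i))))
             (trans (sol′ i) (fromCode d i)))) ⟩
      sum (λ i → c i * sum (λ k → g (J i) (proj₁ (p k)) * d k))
        ≈⟨ sum-cong-≋ (λ i → trans (*-distribˡ-sum (c i) (λ k → g (J i) (proj₁ (p k)) * d k))
             (sum-cong-≋ (λ k → sym (*-assoc (c i) (g (J i) (proj₁ (p k))) (d k))))) ⟩
      sum (λ i → sum (λ k → c i * g (J i) (proj₁ (p k)) * d k))
        ≈⟨ ∑-comm (λ i k → c i * g (J i) (proj₁ (p k)) * d k) ⟩
      sum (λ k → sum (λ i → c i * g (J i) (proj₁ (p k)) * d k))
        ≈⟨ sum-cong-≋ (λ k → *-distribʳ-sum (d k) (λ i → c i * g (J i) (proj₁ (p k)))) ⟨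
      sum (λ k → sum (λ i → c i * g (J i) (proj₁ (p k))) * d k)
        ≈⟨ sum-cong-≋ (λ k → *-congʳ (relation (proj₂ (p k)))) ⟨
      sum (λ k → g a (proj₁ (p k)) * d k)
        ≈⟨ sum-cong-≋ (λ k → *-congʳ (reflexive (≡.cong (g a) (at-P k)))) ⟨
      value (proj₁ family) code d ∎)

-- Filters

module Filters (C : Classical) {I : Set ℓ} (F : Filter I) where

  open Choice C
  open Cardinals C
  open Filter F

  Positive : Pred I ℓ → Set ℓ
  Positive A = ¬ (∁ A ∈ Member)

  meets : ∀ {A S} → Positive A → S ∈ Member → Σ[ i ∈ I ] A i × S i
  meets {A} {S} A⁺ S∈F = dne λ none → A⁺ (upward (λ {i} s x → none (i , x , s)) S∈F)

  -- The atoms of the Boolean algebra of subsets of `I` modulo `F`.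
  Atom : Pred I ℓ → Set (Level.suc ℓ)
  Atom A = Positive A × (∀ B → Positive (A ∩ B) → ¬ Positive (A ∩ ∁ B))

  infix 6 _at

  -- The filter generated by `F` and `A`; it is an ultrafilter when `A` is an atom.
  _at : Pred I ℓ → Filter I
  A at = record
    { Member = λ S → (λ i → A i → S i) ∈ Member
    ; whole = upward (λ _ _ → lift _) whole
    ; upward = λ S⊆T → upward (λ s x → S⊆T (s x))
    ; ∩-closed = λ S T → upward (λ (s , t) x → s x , t x) (∩-closed S T)
    }

  at-ultra : ∀ {A} → Atom A → ∀ S → S ∈ Filter.Member (A at) ⊎ ∁ S ∈ Filter.Member (A at)
  at-ultra {A} (_ , atomic) S with em {P = S ∈ Filter.Member (A at)} | em {P = ∁ S ∈ Filter.Member (A at)}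
  ... | yes p | _     = inj₁ p
  ... | no _  | yes q = inj₂ q
  ... | no ¬p | no ¬q = contradiction
    (λ null → ¬p (upward (λ n x → dne λ ¬s → n (x , ¬s)) null))
    (atomic S λ null → ¬q (upward (λ n x s → n (x , s)) null))

  at-isUltrafilter : ∀ {A} → Atom A → IsUltrafilter (A at)
  at-isUltrafilter {A} atom = record
    { proper = λ all → proj₁ atom (upward (λ f x → lower (f x)) (all (λ _ → Lift ℓ ⊥)))
    ; maximal = λ G G-proper sub {S} S∈G → [ id , (λ ∁S∈ → contradiction
        (λ B → Filter.upward G (λ (s , ¬s) → contradiction s ¬s) (Filter.∩-closed G S∈G (sub ∁S∈)))
        G-proper) ]′
        (at-ultra atom S)
    }

  -- For `A = U` this presents `F` as the intersection of the ultrafilters `piece k at`.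
  record Finite (A : Pred I ℓ) : Set (Level.suc ℓ) where
    field
      size   : ℕ
      piece  : Fin size → Pred I ℓ
      atomic : ∀ k → Atom (piece k)
      covers : (λ i → A i → Σ[ k ∈ Fin size ] piece k i) ∈ Member

  null-finite : ∀ {A} → ¬ Positive A → Finite A
  null-finite null = record
    { size = 0 ; piece = λ () ; atomic = λ ()
    ; covers = upward (λ ¬x x → contradiction x ¬x) (dne null) }

  atom-finite : ∀ {A} → Atom A → Finite A
  atom-finite {A} atom = record
    { size = 1 ; piece = λ _ → A ; atomic = λ _ → atom ; covers = upward (λ _ x → zero , x) whole }

  join-finite : ∀ {A B : Pred I ℓ} → Finite (A ∩ B) → Finite (A ∩ ∁ B) → Finite A
  join-finite {A} {B} P Q = record
    { size = P.size ℕ.+ Q.size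
    ; piece = P.piece Vector.++ Q.piece
    ; atomic = atomic
    ; covers = upward (λ {i} (p , q) x → case em {P = B i} of λ
        { (yes y) → let (k , z) = p (x , y) in
            k ↑ˡ Q.size , ≡.subst (λ A → A i) (≡.sym (lookup-++ˡ P.piece Q.piece k)) z
        ; (no ¬y) → let (k , z) = q (x , ¬y) in
            P.size ↑ʳ k , ≡.subst (λ A → A i) (≡.sym (lookup-++ʳ P.piece Q.piece k)) z })
        (∩-closed P.covers Q.covers)
    }
    where
    module P = Finite P
    module Q = Finite Q
    atomic : ∀ k → Atom ((P.piece Vector.++ Q.piece) k)
    atomic k with splitAt P.size k
    ... | inj₁ j = P.atomic j
    ... | inj₂ j = Q.atomic j

  -- `A` is positive and no atom, so it falls into two positive parts. By `join-finite` they are not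
  -- both finite; one that is not finite is kept.
  split : ∀ {A} → ¬ Finite A → Σ[ B ∈ Pred I ℓ ] B ⊆ A × ¬ Finite B × Positive (A ∩ ∁ B)
  split {A} ¬fin = go em em
    where
    A⁺ : Positive A
    A⁺ null = ¬fin (null-finite (λ A⁺ → A⁺ null))
    go : Dec (Σ[ B ∈ Pred I ℓ ] Positive (A ∩ B) × Positive (A ∩ ∁ B)) →
         (∀ {B} → Dec (Finite (A ∩ B))) →
         Σ[ B ∈ Pred I ℓ ] B ⊆ A × ¬ Finite B × Positive (A ∩ ∁ B)
    go (no none) _ = contradiction (atom-finite (A⁺ , λ B p q → none (B , p , q))) ¬fin
    go (yes (B , p , q)) fin? with fin? {B}
    ... | no ¬f = A ∩ B , proj₁ , ¬f ,
            λ null → q (upward (λ n (x , ¬y) → n (x , λ (_ , y) → ¬y y)) null)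
    ... | yes f = A ∩ ∁ B , proj₁ , (λ f′ → ¬fin (join-finite f f′)) ,
            λ null → p (upward (λ n (x , y) → n (x , λ (_ , ¬y) → ¬y y)) null)

  -- Iterating `split` yields a decreasing chain whose successive differences are infinitely many
  -- disjoint positive sets.
  module Descent {A₀ : Pred I ℓ} (¬fin : ¬ Finite A₀) where

    chain : ℕ → Σ[ A ∈ Pred I ℓ ] ¬ Finite A
    chain ℕ.zero = A₀ , ¬fin
    chain (ℕ.suc n) = let (A , ¬f) = chain n ; (B , _ , ¬g , _) = split ¬f in B , ¬g

    link : ℕ → Pred I ℓ
    link n = proj₁ (chain n)

    layer : ℕ → Pred I ℓ
    layer n = link n ∩ ∁ (link (ℕ.suc n))

    layer-positive : ∀ n → Positive (layer n)
    layer-positive n = proj₂ (proj₂ (proj₂ (split (proj₂ (chain n)))))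

    link-antitone : ∀ {m n} → m ℕ.≤′ n → link n ⊆ link m
    link-antitone ℕ.≤′-refl = id
    link-antitone (ℕ.≤′-step {n} le) = link-antitone le ∘ proj₁ (proj₂ (split (proj₂ (chain n))))

    layer-unique : ∀ {m n i} → layer m i → layer n i → m ≡ n
    layer-unique {m} {n} (p , ¬p) (q , ¬q) with ℕ.<-cmp m n
    ... | tri< lt _ _ = contradiction (link-antitone (ℕ.≤⇒≤′ lt) q) ¬p
    ... | tri≈ _ eq _ = eq
    ... | tri> _ _ gt = contradiction (link-antitone (ℕ.≤⇒≤′ gt) p) ¬q

  module _ {X : Set ℓ} (O : WellOrder X) where

    open WellOrder O

    record Unbounded : Set (Level.suc ℓ) where
      field
        h         : I → X
        domain    : Pred I ℓ
        nonempty  : ∀ {S} → S ∈ Member → Σ[ i ∈ I ] S i × domain i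
        unbounded : ∀ {S} → S ∈ Member → ∀ {i} → S i → domain i →
                    Σ[ j ∈ I ] S j × domain j × h i < h j

    -- With x least such that the values below x are big (if there is one), the
    -- values below x have no maximum on any member of the filter.
    cutoff : (h : I → X) (T : Pred I ℓ) (Big : Pred X ℓ → Set ℓ) →
             (∀ {Q R} → Q ⊆ R → Big Q → Big R) → Big U → ¬ Big (λ _ → Lift ℓ ⊥) →
             (∀ x → Big (λ y → y < x ⊎ y ≡ x) → Big (_< x)) →
             (∀ {S R} → S ∈ Member → Big R → Big (λ x → R x × Σ[ i ∈ I ] S i × T i × h i ≡ x)) →
             Unbounded
    cutoff h T Big mono Big-U ¬Big-∅ remove image = go em
      where
      cut : (R : Pred X ℓ) → Big R → (∀ {x} → R x → ¬ Big (_< x)) → Unbounded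
      cut R Big-R least = record
        { h = h
        ; domain = λ i → T i × R (h i)
        ; nonempty = λ S∈F → dne λ none → ¬Big-∅
            (mono (λ { (r , i , s , t , ≡.refl) → lift (none (i , s , t , r)) }) (image S∈F Big-R))
        -- If `h i` were a maximum, the values up to `h i` would be big, and still big without `h i`
        -- itself, contrary to `least`.
        ; unbounded = λ {S} S∈F {i} s (t , r) → dne λ none → least r (remove (h i)
            (mono (λ { (r′ , j , s′ , t′ , ≡.refl) → below (λ lt → none (j , s′ , (t′ , r′) , lt)) })
              (image S∈F Big-R)))
        }
        where
        below : ∀ {x y} → ¬ (x < y) → y < x ⊎ y ≡ x
        below {x} {y} ¬lt with compare x y
        ... | tri< lt _ _ = contradiction lt ¬lt
        ... | tri≈ _ eq _ = inj₂ (≡.sym eq)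
        ... | tri> _ _ gt = inj₁ gt
      go : Dec (Σ[ x ∈ X ] Big (_< x)) → Unbounded
      go (no none) = cut U Big-U λ _ big → none (_ , big)
      go (yes some) with minimal wellFounded (λ x → Big (_< x)) some
      ... | x , big , least = cut (_< x) big least

    -- `h` sends layer `n` to the `n`th term of the sequence `e`, and a set is big if it contains
    -- terms of arbitrarily high index. Each member of the filter meets every layer, so passing to
    -- it loses no term.
    fromDescent : ℕ ↣ X → {A₀ : Pred I ℓ} → ¬ Finite A₀ → Unbounded
    fromDescent e ¬fin = cutoff h T Big
      (λ Q⊆R big n → let (m , n≤m , q) = big n in m , n≤m , Q⊆R q)
      (λ n → n , ℕ.≤-refl , lift _)
      (λ big → lower (proj₂ (proj₂ (big 0))))
      remove
      (λ S∈F big n → let (m , n≤m , r) = big n ; (i , q , s) = meets (layer-positive m) S∈F in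
        m , n≤m , r , i , s , (m , q) , h-layer q em)
      where
      open Descent ¬fin
      T : Pred I ℓ
      T i = Σ[ n ∈ ℕ ] layer n i
      level : ∀ i → Dec (T i) → X
      level i (yes (n , _)) = to e n
      level i (no _)        = to e 0
      h : I → X
      h i = level i em
      h-layer : ∀ {n i} → layer n i → (d : Dec (T i)) → level i d ≡ to e n
      h-layer q (yes (m , q′)) = ≡.cong (to e) (layer-unique q′ q)
      h-layer {n} q (no ¬t)        = contradiction (n , q) ¬t
      Big : Pred X ℓ → Set ℓ
      Big R = ∀ n → Σ[ m ∈ ℕ ] n ℕ.≤ m × R (to e m)
      remove : ∀ x → Big (λ y → y < x ⊎ y ≡ x) → Big (_< x)
      remove x big n with em {P = Σ[ k ∈ ℕ ] to e k ≡ x}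
      ... | no none with big n
      ...   | m , n≤m , inj₁ lt = m , n≤m , lt
      ...   | m , n≤m , inj₂ eq = contradiction (m , eq) none
      -- An index beyond `k` cannot give the removed term again.
      remove x big n | yes (k , ≡.refl) with big (n ℕ.⊔ ℕ.suc k)
      ...   | m , le , inj₁ lt = m , ℕ.≤-trans (ℕ.m≤m⊔n n (ℕ.suc k)) le , lt
      ...   | m , le , inj₂ eq = contradiction (to-injective e (≡.sym eq))
                (ℕ.<⇒≢ (ℕ.≤-trans (ℕ.m≤n⊔m n (ℕ.suc k)) le))

    -- Almost every point, for the ultrafilter `A at`, misses some `B y`, and `h` records one such
    -- `y`. The fibre over `e y` misses `B y`, hence is null, so deleting one value keeps a set big,
    -- that is, of preimage in the ultrafilter.
    fromIncomplete : X → {A : Pred I ℓ} → Atom A → {Y : Set ℓ} → Y ↣ X →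
      (B : Y → Pred I ℓ) → (∀ y → B y ∈ Filter.Member (A at)) → ¬ (⋂ Y B ∈ Filter.Member (A at)) →
      Unbounded
    fromIncomplete x₀ {A} atom {Y} e B B∈ ¬⋂∈ = cutoff h T Big
      (λ Q⊆R → Filter.upward (A at) (λ (t , q) → t , Q⊆R q))
      (Filter.upward (A at) (λ t → t , lift _) T∈)
      (λ big → proj₁ atom (upward (λ f x → lower (proj₂ (f x))) big))
      remove
      (λ S∈F big → upward (λ (s , f) x → let (t , r) = f x in t , r , _ , s , t , ≡.refl)
        (∩-closed S∈F big))
      where
      T : Pred I ℓ
      T i = Σ[ y ∈ Y ] ¬ B y i
      T∈ : T ∈ Filter.Member (A at)
      T∈ with at-ultra atom T
      ... | inj₁ p = p
      ... | inj₂ q = contradiction (upward (λ f x y → dne λ ¬b → f x (y , ¬b)) q) ¬⋂∈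
      value : ∀ i → Dec (T i) → X
      value i (yes (y , _)) = to e y
      value i (no _)        = x₀
      h : I → X
      h i = value i em
      h-B : ∀ {i y} → T i → B y i → (d : Dec (T i)) → value i d ≢ to e y
      h-B t b (yes (y , ¬b)) eq = ¬b (≡.subst (λ y → B y _) (≡.sym (to-injective e eq)) b)
      h-B t b (no ¬t) eq = ¬t t
      h-image : ∀ {i} → T i → (d : Dec (T i)) → Σ[ y ∈ Y ] to e y ≡ value i d
      h-image t (yes (y , _)) = y , ≡.refl
      h-image t (no ¬t)       = contradiction t ¬t
      Big : Pred X ℓ → Set ℓ
      Big R = (λ i → T i × R (h i)) ∈ Filter.Member (A at)
      remove : ∀ x → Big (λ y → y < x ⊎ y ≡ x) → Big (_< x)
      remove x big with em {P = Σ[ y ∈ Y ] to e y ≡ x}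
      ... | no none = Filter.upward (A at)
              (λ { (t , inj₁ lt) → t , lt
                 ; (t , inj₂ eq) → let (y , eq′) = h-image t em in
                     contradiction (y , ≡.trans eq′ eq) none }) big
      ... | yes (y , ≡.refl) = Filter.upward (A at)
              (λ { ((t , inj₁ lt) , b) → t , lt
                 ; ((t , inj₂ eq) , b) → contradiction eq (h-B t b em) })
              (Filter.∩-closed (A at) big (B∈ y))

    unbounded : (S : Setoid ℓ ℓ) → Setoid.Carrier S → Infinite S → S ≲ X →
      (κ⁺ : Setoid ℓ ℓ) → IsSuccessorCardinal κ⁺ S →
      ¬ IsFiniteIntersectionOfCompleteUltrafilters κ⁺ F → Unbounded
    unbounded S s S-infinite S≲X κ⁺ successor ¬intersection = go em
      where
      open IsSuccessorCardinal successor
      embed : {Y : Set ℓ} → ≡.setoid Y ≺ κ⁺ → Y ↣ X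
      -- If `X` embeds in `Y`, so does `S`. Were `Y` not to embed in `S`, it would be strictly
      -- larger than `S`, and `least` would embed `κ⁺` in `Y`.
      embed {Y} (_ , ¬κ⁺≤Y) = [ id , (λ X↣Y → via X↣Y em) ]′ (comparable Y X)
        where
        via : X ↣ Y → Dec (Injection (≡.setoid Y) S) → Y ↣ X
        via X↣Y (yes i) = mk↣ {to = _≲_.fun S≲X ∘ Injection.to i}
                            (Injection.injective i ∘ _≲_.injective S≲X)
        via X↣Y (no ¬i) = contradiction
          (least (≡.setoid Y) (≲⇒Injection (≲-↣ S≲X X↣Y) , ¬i)) ¬κ⁺≤Y

      Incomplete : (K : Pred I ℓ) → Set (Level.suc ℓ)
      Incomplete K = Σ[ Y ∈ Set ℓ ] (≡.setoid Y ≺ κ⁺) × Σ[ B ∈ (Y → Pred I ℓ) ]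
        (∀ y → B y ∈ Filter.Member (K at)) × ¬ (⋂ Y B ∈ Filter.Member (K at))

      go : Dec (Finite U) → Unbounded
      go (no ¬fin) = fromDescent infinite ¬fin
        where
        infinite : ℕ ↣ X
        infinite = [ id , (λ (_ , e) → contradiction (≲-↣ S≲X e) (Infinite⇒⋦Fin s S-infinite)) ]′
                     (infinite⊎finite X)
      go (yes fin) with em {P = Σ[ k ∈ Fin (Finite.size fin) ] Incomplete (Finite.piece fin k)}
      ... | yes (k , Y , Y≺κ⁺ , B , B∈ , ¬⋂∈) =
        fromIncomplete (_≲_.fun S≲X s) (Finite.atomic fin k) (embed Y≺κ⁺) B B∈ ¬⋂∈
      ... | no none = contradiction
        ( size , (λ k → piece k at)
        , (λ k → at-isUltrafilter (atomic k) ,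
            λ Y Y≺κ⁺ B B∈ → dne λ ¬⋂∈ → none (k , Y , Y≺κ⁺ , B , B∈ , ¬⋂∈))
        , λ A → mk⇔ (λ A∈F k → upward (λ x _ → x) A∈F)
            λ A∈ → upward (λ (cover , inside) → let (k , z) = cover (lift _) in inside k z)
              (∩-closed covers (intersection size piece A∈)))
        ¬intersection
        where
        open Finite fin
        intersection : ∀ n (K : Fin n → Pred I ℓ) {A} → (∀ k → A ∈ Filter.Member (K k at)) →
                       (λ i → ∀ k → K k i → A i) ∈ Member
        intersection ℕ.zero K A∈ = upward (λ _ ()) whole
        intersection (ℕ.suc n) K A∈ = upward (λ { (p , q) zero → p ; (p , q) (suc k) → q k })
          (∩-closed (A∈ zero) (intersection n (K ∘ suc) (A∈ ∘ suc)))

-- The left and right dimensions of the reduced power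

opposite : DivisionRing ℓ ℓ → DivisionRing ℓ ℓ
opposite D = record
  { ring = Op.ring D.ring
  ; 1≉0 = D.1≉0
  ; invertible = λ x x≉0 → let (y , yx≈1 , xy≈1) = D.invertible x x≉0 in y , xy≈1 , yx≈1
  }
  where module D = DivisionRing D

leftDimension : Classical → (D : DivisionRing ℓ ℓ) → Infinite (DivisionRing.setoid D) →
  (I : Set ℓ) (F : Filter I)
  (κ⁺ : Setoid ℓ ℓ) → IsSuccessorCardinal κ⁺ (DivisionRing.setoid D) →
  ¬ IsFiniteIntersectionOfCompleteUltrafilters κ⁺ F →
  HasLeftDimension (Bimodule.leftModule (reducedPower D F)) (Bimodule.≈ᴹ-setoid (reducedPower D F))
leftDimension {ℓ} C D D-infinite I F κ⁺ successor ¬intersection =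
  dimension≡cardinality C D V D-infinite order embed f f-new
  where
  module D = DivisionRing D
  V = Bimodule.leftModule (reducedPower D F)
  open LeftModule V using (+ᴹ-rawMonoid; _*ₗ_)
  open Spans D V
  open Bases C using (combination)
  open Family C D D-infinite
  open WellOrder order
  open Filters C F using (Unbounded; unbounded)
  open Unbounded (unbounded order D.setoid D.0# D-infinite embed κ⁺ successor ¬intersection)
    using (h; domain; nonempty) renaming (unbounded to h-unbounded)

  f : X → I → D.Carrier
  f a i = g a (h i)

  sum-at : ∀ {n} (t : Fin n → I → D.Carrier) i →
           rawSum +ᴹ-rawMonoid t i ≡ rawSum D.+-rawMonoid (λ j → t j i)
  sum-at {ℕ.zero}  t i = ≡.refl
  sum-at {ℕ.suc n} t i = ≡.cong (t zero i D.+_) (sum-at (t ∘ suc) i)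

  f-new : ∀ a → ¬ Span f (_< a) (f a)
  -- `equation` says that the indices where the relation holds form a member of the filter; `Values`
  -- is the image under `h` of that set within `domain`.
  f-new a s = g-independent point distinct allowed coeff Values
    (let (i , e , t) = nonempty equation in h i , i , e , t , ≡.refl)
    (λ { (i , e , t , ≡.refl) → let (j , e′ , t′ , lt) = h-unbounded equation e t in
           h j , (j , e′ , t′ , ≡.refl) , lt })
    (λ { (i , e , _ , ≡.refl) → D.trans e (D.reflexive (sum-at (λ j → coeff j *ₗ f (point j)) i)) })
    where
    open Combination (combination s)
    Values : X → Set ℓ
    Values x = Σ[ i ∈ I ] f a i D.≈ rawSum +ᴹ-rawMonoid (λ j → coeff j *ₗ f (point j)) i
                        × domain i × h i ≡ x

theorem11 : Classical →
    ∀ {ℓ : Level} (D : DivisionRing ℓ ℓ) → Infinite (DivisionRing.setoid D) →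
    (I : Set ℓ) (F : Filter I)
    (κ⁺ : Setoid ℓ ℓ) → IsSuccessorCardinal κ⁺ (DivisionRing.setoid D) →
    ¬ IsFiniteIntersectionOfCompleteUltrafilters κ⁺ F →
    HasLeftDimension (Bimodule.leftModule (reducedPower D F)) (Bimodule.≈ᴹ-setoid (reducedPower D F)) ×
    HasRightDimension (Bimodule.rightModule (reducedPower D F)) (Bimodule.≈ᴹ-setoid (reducedPower D F))
theorem11 C D D-infinite I F κ⁺ successor ¬intersection =
  leftDimension C D D-infinite I F κ⁺ successor ¬intersection ,
  -- Left scalars over the opposite ring act as right scalars over `D`, so the basis conditions
  -- carry over unchanged.
  let (B , e , isBasis , bijection) = leftDimension C (opposite D) D-infinite I F κ⁺ successor ¬intersection
      open Basis.IsBasis isBasis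
  in B , e
       , record { congruent = congruent ; linearlyIndependent = linearlyIndependent ; spanning = spanning }
       , bijection
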